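{- There is an algorithm that, given a Sperner hypergraph $\mathcal{K}\subseteq 2^V$, decides in $O(|V|^3\cdot|\mathcal{K}|\cdot\|\mathcal{K}\|^2)$ time whether $\mathcal{K}$ is realizable as the key set of a hypergraph Horn function (i.e. whether $\mathcal{K}=\mathcal{K}(h)$ for some hypergraph Horn function $h$ on $V$), and if yes, constructs (within the same time bound) a hypergraph $\mathcal{H}\subseteq 2^V$ such that $\mathcal{K}=\mathcal{K}(\Phi_{\mathcal{H}})$ and $|\mathcal{H}|\le|V|\cdot|\mathcal{K}|$.
   Context: $V$ is a finite set of Boolean variables; a Boolean function on $V$ is a map $2^V\to\{0,1\}$, and its true sets are the sets on which it equals $1$. A hypergraph is a family $\mathcal{K}\subseteq 2^V$; it is Sperner if no two distinct hyperedges contain one another, and $\|\mathcal{K}\|=\sum_{K\in\mathcal{K}}|K|$. For $B\subsetneq V$ and $v\in V\setminus B$, the definite Horn clause $B\to v$ has as true sets the sets $T$ with $B\not\subseteq T$ or $B\cup\{v\}\subseteq T$. A definite Horn function is one representable as a finite conjunction of definite Horn clauses (the empty conjunction is the constant $1$). For a definite Horn function $h$ and $Z\subseteq V$, $\mathbb{T}_h(Z)$ is the unique smallest true set of $h$ containing $Z$. The key set $\mathcal{K}(h)$ of $h$ is the family of inclusionwise minimal sets $K\subseteq V$ with $\mathbb{T}_h(K)=V$. For a hypergraph $\mathcal{H}\subseteq 2^V$, let $\Phi_{\mathcal{H}}=\bigwedge_{H\in\mathcal{H}}\bigwedge_{v\in H}((H\setminus\{v\})\to v)$. A definite Horn function is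 hypergraph Horn if it equals $\Phi_{\mathcal{H}}$ for some hypergraph $\mathcal{H}\subseteq 2^V$. -}

module Defs where

open import Data.Bool.Base using (Bool; true; if_then_else_)
open import Data.Bool.ListAction using (all)
open import Data.Fin.Base using (Fin; zero; suc; toℕ)
open import Data.Fin.Subset using (Subset; _∈_; _∉_; _⊆_; _∪_; _-_; ⁅_⁆; ⊤; ∣_∣)
open import Data.Fin.Subset.Properties using (_∈?_; _⊆?_)
open import Data.List.Base
  using (List; []; _∷_; map; length; concatMap; filter; allFin; lookup)
import Data.List.Membership.Propositional as List
open import Data.Nat.Base using (ℕ; zero; suc; _+_; _∸_; _≡ᵇ_)
open import Data.Nat.ListAction using (sum)
open import Data.Product.Base using (∃-syntax; _×_; _,_)
open import Data.Vec.Base using (_∷_; here; there)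
open import Function.Bundles using (_⇔_)
open import Relation.Binary.PropositionalEquality
  using (_≡_; _≢_; _≗_; refl)
open import Relation.Nullary using (¬_; contradiction)
open import Relation.Nullary.Decidable using (⌊_⌋; ¬?; _⊎-dec_)

------------------------------------------------------------------------
-- Hypergraphs on V = Fin n

-- A family of subsets is given by a list of its members.  When the list has
-- no repetition, `length` is the number of hyperedges and ‖_‖ the sum of
-- their sizes; with repetitions both over-count, so an upper bound on
-- `length` is also one on the cardinality of the family.

Hypergraph : ℕ → Set
Hypergraph n = List (Subset n)

‖_‖ : ∀ {n} → Hypergraph n → ℕ
‖ 𝒦 ‖ = sum (map ∣_∣ 𝒦)

Sperner : ∀ {n} → Hypergraph n → Set
Sperner 𝒦 = ∀ K K′ → K List.∈ 𝒦 → K′ List.∈ 𝒦 → K ≢ K′ → ¬ (K ⊆ K′)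

------------------------------------------------------------------------
-- Definite Horn functions

BoolFun : ℕ → Set
BoolFun n = Subset n → Bool

TrueSet : ∀ {n} → BoolFun n → Subset n → Set
TrueSet h T = h T ≡ true

-- `head∉body` also gives body ≠ V.

record Clause (n : ℕ) : Set where
  constructor clause
  field
    body      : Subset n
    head      : Fin n
    head∉body : head ∉ body

⟦_⟧ᶜ : ∀ {n} → Clause n → BoolFun n
⟦ clause B v _ ⟧ᶜ T = ⌊ ¬? (B ⊆? T) ⊎-dec ((B ∪ ⁅ v ⁆) ⊆? T) ⌋

⋀ : ∀ {n} → List (Clause n) → BoolFun n
⋀ cs T = all (λ c → ⟦ c ⟧ᶜ T) cs

DefiniteHorn : ∀ {n} → BoolFun n → Set
DefiniteHorn {n} h = ∃[ cs ] h ≗ ⋀ {n} cs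

x∉p-x : ∀ {n} (x : Fin n) (p : Subset n) → x ∉ p - x
x∉p-x zero    (_ ∷ _) ()
x∉p-x (suc x) (_ ∷ p) (there x∈) = x∉p-x x p x∈

members : ∀ {n} → Subset n → List (Fin n)
members {n} H = filter (_∈? H) (allFin n)

edgeClauses : ∀ {n} → Subset n → List (Clause n)
edgeClauses H = map (λ v → clause (H - v) v (x∉p-x v H)) (members H)

Φ : ∀ {n} → Hypergraph n → BoolFun n
Φ ℋ = ⋀ (concatMap edgeClauses ℋ)

HypergraphHorn : ∀ {n} → BoolFun n → Set
HypergraphHorn {n} h = DefiniteHorn h × (∃[ ℋ ] h ≗ Φ {n} ℋ)

------------------------------------------------------------------------
-- Key sets

-- The relation T = 𝕋_h(Z).

record SmallestTrueSet {n} (h : BoolFun n) (Z T : Subset n) : Set where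
  field
    isTrue   : TrueSet h T
    contains : Z ⊆ T
    smallest : ∀ T′ → TrueSet h T′ → Z ⊆ T′ → T ⊆ T′

Generates : ∀ {n} → BoolFun n → Subset n → Set
Generates h K = SmallestTrueSet h K ⊤

MinimalKey : ∀ {n} → BoolFun n → Subset n → Set
MinimalKey h K = Generates h K × (∀ K′ → Generates h K′ → K′ ⊆ K → K′ ≡ K)

-- 𝒦 = 𝒦(h), as families of sets.

IsKeySetOf : ∀ {n} → Hypergraph n → BoolFun n → Set
IsKeySetOf 𝒦 h = ∀ K → (K List.∈ 𝒦) ⇔ MinimalKey h K

Realizable : ∀ {n} → Hypergraph n → Set
Realizable {n} 𝒦 = ∃[ h ] (HypergraphHorn {n} h × IsKeySetOf 𝒦 h)

------------------------------------------------------------------------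
-- Algorithms: structured programs for a unit-cost random access machine

-- The machine has scalar variables and arrays, both named by numerals; a
-- program mentions only finitely many of them.  Cells hold natural numbers.
-- The arithmetic operations are addition and truncated subtraction;
-- multiplication is omitted, as usual for the unit-cost measure.  A program
-- is a fixed finite text, independent of the input.

infixl 7 _⊕_ _⊖_
infix  6 _:=_ _[_]:=_
infixr 5 _⨾_

data Expr : Set where
  lit     : ℕ → Expr
  var     : ℕ → Expr
  _[_]    : ℕ → Expr → Expr
  _⊕_ _⊖_ : Expr → Expr → Expr

data Program : Set where
  skip           : Program
  _:=_           : ℕ → Expr → Program
  _[_]:=_        : ℕ → Expr → Expr → Program
  _⨾_            : Program → Program → Program
  if_then_else′_ : Expr → Program → Program → Program
  while_loop_    : Expr → Program → Program

record State : Set where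
  constructor state
  field
    vars   : ℕ → ℕ
    arrays : ℕ → ℕ → ℕ
open State public

update : ∀ {A : Set} → (ℕ → A) → ℕ → A → ℕ → A
update f k a j = if j ≡ᵇ k then a else f j

setVar : State → ℕ → ℕ → State
setVar (state vs as) x a = state (update vs x a) as

setCell : State → ℕ → ℕ → ℕ → State
setCell (state vs as) x i a = state vs (update as x (update (as x) i a))

⟦_⟧ : Expr → State → ℕ
⟦ lit k ⟧   σ = k
⟦ var x ⟧   σ = vars σ x
⟦ x [ e ] ⟧ σ = arrays σ x (⟦ e ⟧ σ)
⟦ e ⊕ e′ ⟧  σ = ⟦ e ⟧ σ + ⟦ e′ ⟧ σ
⟦ e ⊖ e′ ⟧  σ = ⟦ e ⟧ σ ∸ ⟦ e′ ⟧ σ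

cost : Expr → ℕ
cost (lit _)   = 1
cost (var _)   = 1
cost (x [ e ]) = 1 + cost e
cost (e ⊕ e′)  = 1 + (cost e + cost e′)
cost (e ⊖ e′)  = 1 + (cost e + cost e′)

-- ⟨ p , σ ⟩⇓⟨ τ , t ⟩ : started in state σ, program p halts in state τ after
-- t steps.  A condition holds when its value is nonzero.

data ⟨_,_⟩⇓⟨_,_⟩ : Program → State → State → ℕ → Set where

  ⇓skip   : ∀ {σ} → ⟨ skip , σ ⟩⇓⟨ σ , 1 ⟩

  ⇓assign : ∀ {σ x e} →
            ⟨ x := e , σ ⟩⇓⟨ setVar σ x (⟦ e ⟧ σ) , 1 + cost e ⟩

  ⇓store  : ∀ {σ x e e′} →
            ⟨ x [ e ]:= e′ , σ ⟩⇓⟨ setCell σ x (⟦ e ⟧ σ) (⟦ e′ ⟧ σ)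
                                 , 1 + (cost e + cost e′) ⟩

  ⇓seq    : ∀ {σ τ υ p q s t} →
            ⟨ p , σ ⟩⇓⟨ τ , s ⟩ → ⟨ q , τ ⟩⇓⟨ υ , t ⟩ →
            ⟨ p ⨾ q , σ ⟩⇓⟨ υ , s + t ⟩

  ⇓then   : ∀ {σ τ e p q t} → ⟦ e ⟧ σ ≢ 0 →
            ⟨ p , σ ⟩⇓⟨ τ , t ⟩ →
            ⟨ if e then p else′ q , σ ⟩⇓⟨ τ , 1 + (cost e + t) ⟩

  ⇓else   : ∀ {σ τ e p q t} → ⟦ e ⟧ σ ≡ 0 →
            ⟨ q , σ ⟩⇓⟨ τ , t ⟩ →
            ⟨ if e then p else′ q , σ ⟩⇓⟨ τ , 1 + (cost e + t) ⟩

  ⇓stop   : ∀ {σ e p} → ⟦ e ⟧ σ ≡ 0 →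
            ⟨ while e loop p , σ ⟩⇓⟨ σ , 1 + cost e ⟩

  ⇓iter   : ∀ {σ τ υ e p s t} → ⟦ e ⟧ σ ≢ 0 →
            ⟨ p , σ ⟩⇓⟨ τ , s ⟩ → ⟨ while e loop p , τ ⟩⇓⟨ υ , t ⟩ →
            ⟨ while e loop p , σ ⟩⇓⟨ υ , 1 + (cost e + (s + t)) ⟩

-- Hence the final state and the running time are functions of p and σ.

deterministic : ∀ {p σ τ τ′ t t′} →
                ⟨ p , σ ⟩⇓⟨ τ , t ⟩ → ⟨ p , σ ⟩⇓⟨ τ′ , t′ ⟩ → (τ , t) ≡ (τ′ , t′)
deterministic ⇓skip   ⇓skip   = refl
deterministic ⇓assign ⇓assign = refl
deterministic ⇓store  ⇓store  = refl
deterministic (⇓seq a b) (⇓seq a′ b′) with deterministic a a′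
... | refl with deterministic b b′
... | refl = refl
deterministic (⇓then _ a) (⇓then _ a′) with deterministic a a′
... | refl = refl
deterministic (⇓then ≢0 _) (⇓else ≡0 _) = contradiction ≡0 ≢0
deterministic (⇓else ≡0 _) (⇓then ≢0 _) = contradiction ≡0 ≢0
deterministic (⇓else _ a) (⇓else _ a′) with deterministic a a′
... | refl = refl
deterministic (⇓stop _)  (⇓stop _)      = refl
deterministic (⇓stop ≡0) (⇓iter ≢0 _ _) = contradiction ≡0 ≢0
deterministic (⇓iter ≢0 _ _) (⇓stop ≡0) = contradiction ≡0 ≢0
deterministic (⇓iter _ a b) (⇓iter _ a′ b′) with deterministic a a′
... | refl with deterministic b b′
... | refl = refl

------------------------------------------------------------------------
-- Input and output

-- A hypergraph is presented to the machine as its number of hyperedges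
-- followed by, for each hyperedge, its size and its elements (numbered from
-- 0, in increasing order).

encodeEdge : ∀ {n} → Subset n → List ℕ
encodeEdge H = ∣ H ∣ ∷ map toℕ (members H)

encode : ∀ {n} → Hypergraph n → List ℕ
encode ℋ = length ℋ ∷ concatMap encodeEdge ℋ

-- The i-th entry, or 0 beyond the end.

at : List ℕ → ℕ → ℕ
at []       _       = 0
at (w ∷ _)  zero    = w
at (_ ∷ ws) (suc i) = at ws i

-- Array 0 holds the input, |V| followed by the code of 𝒦; every other cell
-- is 0.

inputArrays : List ℕ → ℕ → ℕ → ℕ
inputArrays ws zero    = at ws
inputArrays ws (suc _) = λ _ → 0

initial : ∀ {n} → Hypergraph n → State
initial {n} 𝒦 = state (λ _ → 0) (inputArrays (n ∷ encode 𝒦))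

-- The output is read from array 1.

Outputs : State → List ℕ → Set
Outputs σ ws = ∀ i → arrays σ 1 (toℕ i) ≡ lookup ws i

{-# OPTIONS --safe #-}

-- Call a set H stable if for all K ∈ 𝒦 and u ∈ H ∩ K some K′ ∈ 𝒦 avoids u and
-- lies in H ∪ K.  Every hyperedge H of a hypergraph realizing 𝒦 is stable:
-- X = (H ∪ K) − u spans V, because H adds u and then K ⊆ X + u adds everything,
-- so X contains a key, and this key avoids u.  Conversely, if all hyperedges of
-- ℋ are stable, then a set X containing no member of 𝒦 does not span V.  By
-- induction on |V ∖ X|, no larger such set does.  If X spans V, it is therefore
-- closed: for H − v ⊆ X with v ∉ X, the spanning set X + v contains some K ∈ 𝒦,
-- and then K′ ∌ v lies in H ∪ K ⊆ X + v, hence in X.  So X = V, a contradiction.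
--
-- Stable sets are closed under union, so each set S contains a largest one; it
-- is found by deleting u from S as long as some K ∈ 𝒦 with u ∈ K violates the
-- condition.  The algorithm starts from T = K for each K ∈ 𝒦 and, as long as
-- possible, adds to T a vertex v that belongs to the largest stable subset of
-- T + v, and outputs this subset.  𝒦 is realizable iff always T = V in the end.

module Submission where

open import Defs
open import Data.Bool.Base using (Bool; true; false; _∨_; _∧_; not; if_then_else_)
  renaming (T to IsTrue)
import Data.Bool.Properties as Bool
open import Data.Fin.Base using (Fin; zero; suc; toℕ)
import Data.Fin.Properties as Fin
open import Data.Fin.Subset
  using (Subset; ∣_∣; ⊤; ⊥; _∈_; _∉_; _⊆_; _∪_; _-_; ⁅_⁆)
open import Data.Fin.Subset.Properties
open import Data.List.Base
  using (List; []; _∷_; _++_; _∷ʳ_; map; length; foldl; filter; concatMap; tabulate; allFin)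
  renaming (lookup to lookupᴸ)
import Data.List.Membership.Propositional as List
import Data.List.Membership.Propositional.Properties as List
open import Data.List.Properties
  using ( length-map; length-tabulate; map-tabulate; ++-assoc; length-++; concatMap-++; ++-identityʳ
        ; map-++)
open import Data.List.Relation.Unary.All as All using (All; []; _∷_)
import Data.List.Relation.Unary.All.Properties as All
open import Data.List.Relation.Unary.AllPairs using ([]; _∷_)
open import Data.List.Relation.Unary.Any using (here; there; any?)
open import Data.List.Relation.Unary.Unique.Propositional using (Unique)
open import Data.Nat.Base hiding (∣_-_∣)
open import Data.Nat.ListAction using (sum)
open import Data.Nat.Properties
open import Data.Nat.Solver using (module +-*-Solver)
open import Data.Product.Base using (Σ-syntax; _×_; _,_; proj₁; proj₂)
open import Data.Sum.Base using (_⊎_; inj₁; inj₂; [_,_]′)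
open import Data.Unit.Base using (tt) renaming (⊤ to Unit)
open import Data.Vec.Base using ([]; _∷_; lookup; _[_]≔_)
open import Data.Vec.Properties
  using ( lookup∘update; lookup∘update′; lookup-replicate; lookup⇒[]=; []=⇒lookup
        ; []≔-idempotent; []≔-lookup; []≔-updates; []≔-minimal; ≡-dec)
open import Function.Base using (_∘_; id; const; case_of_)
open import Function.Bundles using (Equivalence; mk⇔)
open import Relation.Binary.Definitions using (DecidableEquality)
open import Relation.Binary.PropositionalEquality hiding ([_])
open import Relation.Nullary using (¬_; Dec; contradiction; does; yes; no)
open import Relation.Nullary.Decidable using (decidable-stable; toWitness)

private variable
  n : ℕ
  A S : Set

-- The cost calculus

writesVar : Program → ℕ → Bool
writesVar skip                     x = false
writesVar (y := _)                 x = x ≡ᵇ y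
writesVar (_ [ _ ]:= _)            x = false
writesVar (p ⨾ q)                  x = writesVar p x ∨ writesVar q x
writesVar (if _ then p else′ q)    x = writesVar p x ∨ writesVar q x
writesVar (while _ loop p)         x = writesVar p x

writesArray : Program → ℕ → Bool
writesArray skip                   k = false
writesArray (_ := _)               k = false
writesArray (a [ _ ]:= _)          k = k ≡ᵇ a
writesArray (p ⨾ q)                k = writesArray p k ∨ writesArray q k
writesArray (if _ then p else′ q)  k = writesArray p k ∨ writesArray q k
writesArray (while _ loop p)       k = writesArray p k

-- Both side conditions are Booleans computed from the program text, so for a concrete program they
-- hold by `refl`.
record Frame (p : Program) (σ τ : State) : Set where
  constructor mkFrame
  field
    var≡   : ∀ x → writesVar p x ≡ false → vars τ x ≡ vars σ x
    array≡ : ∀ k → writesArray p k ≡ false → arrays τ k ≡ arrays σ k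
open Frame

frame-refl : ∀ {p σ} → Frame p σ σ
frame-refl = mkFrame (λ _ _ → refl) (λ _ _ → refl)

frame-trans : ∀ {p σ τ υ} → Frame p σ τ → Frame p τ υ → Frame p σ υ
frame-trans f g = mkFrame (λ x w → trans (var≡ g x w) (var≡ f x w))
                          (λ k w → trans (array≡ g k w) (array≡ f k w))

∨-falseˡ : ∀ {a b} → a ∨ b ≡ false → a ≡ false
∨-falseˡ {false} _ = refl

∨-falseʳ : ∀ {a b} → a ∨ b ≡ false → b ≡ false
∨-falseʳ {false} e = e

frame-seqˡ : ∀ {p q σ τ} → Frame p σ τ → Frame (p ⨾ q) σ τ
frame-seqˡ f = mkFrame (λ x → var≡ f x ∘ ∨-falseˡ) (λ k → array≡ f k ∘ ∨-falseˡ)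

frame-seqʳ : ∀ {p q σ τ} → Frame q σ τ → Frame (p ⨾ q) σ τ
frame-seqʳ {p} f = mkFrame (λ x → var≡ f x ∘ ∨-falseʳ {writesVar p x})
                           (λ k → array≡ f k ∘ ∨-falseʳ {writesArray p k})

update-minimal : ∀ {A : Set} (f : ℕ → A) k a {j} → (j ≡ᵇ k) ≡ false → update f k a j ≡ f j
update-minimal f k a eq rewrite eq = refl

update-updates : ∀ {A : Set} (f : ℕ → A) k a → update f k a k ≡ a
update-updates f k a with k ≡ᵇ k | ≡⇒≡ᵇ k k refl
... | true | _ = refl

update-minimal-≢ : ∀ {A : Set} (f : ℕ → A) k a {j} → j ≢ k → update f k a j ≡ f j
update-minimal-≢ f k a {j} j≢k with j ≡ᵇ k | ≡ᵇ⇒≡ j k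
... | true  | eq = contradiction (eq tt) j≢k
... | false | _  = refl

frame : ∀ {p σ τ t} → ⟨ p , σ ⟩⇓⟨ τ , t ⟩ → Frame p σ τ
frame ⇓skip = frame-refl
frame (⇓assign {σ} {x}) = mkFrame (λ _ → update-minimal (vars σ) x _) (λ _ _ → refl)
frame (⇓store {σ} {a}) = mkFrame (λ _ _ → refl) (λ _ → update-minimal (arrays σ) a _)
frame (⇓seq {p = p} {q} d e) =
  frame-trans (frame-seqˡ (frame d)) (frame-seqʳ {p} (frame e))
frame (⇓then {p = p} {q} _ d) with frame d
... | f = mkFrame (λ x → var≡ f x ∘ ∨-falseˡ) (λ k → array≡ f k ∘ ∨-falseˡ)
frame (⇓else {p = p} {q} _ d) with frame d
... | f = mkFrame (λ x → var≡ f x ∘ ∨-falseʳ {writesVar p x})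
                  (λ k → array≡ f k ∘ ∨-falseʳ {writesArray p k})
frame (⇓stop _) = frame-refl
frame (⇓iter _ d e) with frame d | frame e
... | f | g = mkFrame (λ x w → trans (var≡ g x w) (var≡ f x w))
                      (λ k w → trans (array≡ g k w) (array≡ f k w))

-- The time spent per unit of work by p, when every loop in p accounts for its
-- iterations as units of work.
weight : Program → ℕ
weight skip                    = 1
weight (x := e)                = 1 + cost e
weight (x [ e ]:= e′)          = 1 + (cost e + cost e′)
weight (p ⨾ q)                 = weight p + weight q
weight (if e then p else′ q)   = 1 + (cost e + (weight p + weight q))
weight (while e loop p)        = 1 + (cost e + weight p)

-- A total correctness triple. `W` counts units of work; the factor `weight p`, fixed by the text of
-- `p`, turns them into steps.
record Runs (p : Program) (σ : State) (W : ℕ) (Q : State → Set) : Set where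
  constructor runs
  field
    {end}  : State
    {time} : ℕ
    exec   : ⟨ p , σ ⟩⇓⟨ end , time ⟩
    bound  : time ≤ weight p * W
    post   : Q end

private variable
  p q : Program
  σ : State
  W W′ : ℕ
  Q Q′ : State → Set

map-post : Runs p σ W Q → (∀ {τ} → Frame p σ τ → Q τ → Q′ τ) → Runs p σ W Q′
map-post (runs d b a) f = runs d b (f (frame d) a)

weaken : W ≤ W′ → Runs p σ W Q → Runs p σ W′ Q
weaken {p = p} le (runs d b a) = runs d (≤-trans b (*-monoʳ-≤ (weight p) le)) a

skipR : .⦃ NonZero W ⦄ → Q σ → Runs skip σ W Q
skipR {W} = runs ⇓skip (m≤m*n 1 W)

assign : ∀ {x e} .⦃ _ : NonZero W ⦄ → Q (setVar σ x (⟦ e ⟧ σ)) → Runs (x := e) σ W Q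
assign {W} {e = e} = runs ⇓assign (m≤m*n (1 + cost e) W)

store : ∀ {a e e′} .⦃ _ : NonZero W ⦄ → Q (setCell σ a (⟦ e ⟧ σ) (⟦ e′ ⟧ σ)) →
        Runs (a [ e ]:= e′) σ W Q
store {W} {e = e} {e′} = runs ⇓store (m≤m*n (1 + (cost e + cost e′)) W)

-- The weights add up, so both parts may be granted the same `W`.
seq : Runs p σ W (λ τ → Runs q τ W Q) → Runs (p ⨾ q) σ W Q
seq {p} {W = W} {q} (runs d b (runs d′ b′ a)) =
  runs (⇓seq d d′) (≤-trans (+-mono-≤ b b′) (≤-reflexive
      (sym (*-distribʳ-+ W (weight p) (weight q))))) a

branch : ∀ {e} .⦃ _ : NonZero W ⦄ → (⟦ e ⟧ σ ≢ 0 → Runs p σ W Q) → (⟦ e ⟧ σ ≡ 0 → Runs q σ W Q) →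
         Runs (if e then p else′ q) σ W Q
branch {W} {σ} {p} {q = q} {e} f g = go (⟦ e ⟧ σ ≟ 0)
  where
  fits : ∀ {t} → t ≤ (weight p + weight q) * W → 1 + (cost e + t) ≤ weight (if e then p else′ q) * W
  fits le = ≤-trans (+-mono-≤ (m≤m*n (1 + cost e) W) le)
                    (≤-reflexive (sym (*-distribʳ-+ W (1 + cost e) (weight p + weight q))))
  go : Dec (⟦ e ⟧ σ ≡ 0) → Runs (if e then p else′ q) σ W _
  go (yes z) with g z
  ... | runs d b a = runs (⇓else z d) (fits (≤-trans b (*-monoˡ-≤ W (m≤n+m (weight q) (weight p))))) a
  go (no nz) with f nz
  ... | runs d b a = runs (⇓then nz d) (fits (≤-trans b (*-monoˡ-≤ W (m≤m+n (weight p) (weight q))))) a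

stop : ∀ {e} .⦃ _ : NonZero W ⦄ → ⟦ e ⟧ σ ≡ 0 → Q σ → Runs (while e loop p) σ W Q
stop {W} {p = p} {e = e} z = runs (⇓stop z) (≤-trans (m≤m+n (1 + cost e) (weight p))
    (m≤m*n (weight (while e loop p)) W))

-- Here the weight stays the same and the work adds up: this pass gets `W`, the remaining ones `W′`.
iter : ∀ {e} .⦃ _ : NonZero W ⦄ → ⟦ e ⟧ σ ≢ 0 →
       Runs p σ W (λ τ → Runs (while e loop p) τ W′ Q) → Runs (while e loop p) σ (W + W′) Q
iter {W} {p = p} {W′ = W′} {e = e} nz (runs {time = s} d b (runs {time = t} d′ b′ a)) = runs
    (⇓iter nz d d′) le a
  where
  k = 1 + cost e
  open ≤-Reasoning
  le : k + (s + t) ≤ (k + weight p) * (W + W′)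
  le = begin
    k + (s + t)
      ≤⟨ +-mono-≤ (m≤m*n k W) (+-mono-≤ b b′) ⟩
    k * W + (weight p * W + (k + weight p) * W′)
      ≡⟨ sym (+-assoc (k * W) _ _) ⟩
    k * W + weight p * W + (k + weight p) * W′
      ≡⟨ cong (_+ (k + weight p) * W′) (sym (*-distribʳ-+ W k (weight p))) ⟩
    (k + weight p) * W + (k + weight p) * W′
      ≡⟨ sym (*-distribˡ-+ (k + weight p) W W′) ⟩
    (k + weight p) * (W + W′) ∎

-- Counted loops

advance : ℕ → ℕ → Expr → Program
advance r e next = r := next ⨾ e := var e ⊖ lit 1

-- `count` is evaluated after the pointer is set, so it sees the new value of `r`; hence the
-- condition on `q` and `r` in `forMembers-spec`.
for : (r e : ℕ) (start count next : Expr) → Program → Program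
for r e start count next body =
  r := start ⨾ (e := count ⨾ while var e loop (body ⨾ advance r e next))

≡ᵇ-sym : ∀ a b → (a ≡ᵇ b) ≡ (b ≡ᵇ a)
≡ᵇ-sym zero    zero    = refl
≡ᵇ-sym zero    (suc _) = refl
≡ᵇ-sym (suc _) zero    = refl
≡ᵇ-sym (suc a) (suc b) = ≡ᵇ-sym a b

-- Traversal of a list xs of data: r points to the remaining part of the list
-- (as expressed by Points), and e counts its elements.
for-spec :
  ∀ {A S : Set} {r e start count next body} (f : S → A → S) (I : S → State → Set)
    (Points : List A → ℕ → Set) (w : A → ℕ) {xs s σ} →
  (r ≡ᵇ e) ≡ false →
  writesVar body r ≡ false →
  writesVar body e ≡ false →
  (∀ x → NonZero (w x)) →
  (∀ {s σ} a b → I s σ → I s (setVar (setVar σ r a) e b)) →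
  (let loop = for r e start count next body) →
  (∀ {x xs τ} → Frame loop σ τ → Points (x ∷ xs) (vars τ r) → Points xs (⟦ next ⟧ τ)) →
  (∀ {s x xs τ} → Frame loop σ τ → Points (x ∷ xs) (vars τ r) → I s τ → Runs body τ (w x) (I (f s x))) →
  Points xs (⟦ start ⟧ σ) →
  ⟦ count ⟧ (setVar σ r (⟦ start ⟧ σ)) ≡ length xs →
  I s σ →
  Runs loop σ (suc (sum (map w xs))) (I (foldl f s xs))
for-spec {A} {S} {r} {e} {start} {count} {next} {body} f I Points w {xs} {s} {σ}
  r≢e body∌r body∌e w≢0 I-resp point-next body-spec points counts i =
  seq (assign (seq (assign (go xs s
    (frame-trans (frame-seqˡ (frame ⇓assign)) (frame-seqʳ {r := start} (frame-seqˡ (frame ⇓assign))))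
    (subst (Points xs) (sym (trans (update-minimal (vars σ₀) e _ r≢e)
        (update-updates (vars σ) r _))) points)
    (trans (update-updates (vars σ₀) e _) counts)
    (I-resp _ _ i)))))
  where
  loop = for r e start count next body
  σ₀ = setVar σ r (⟦ start ⟧ σ)
  body′ = body ⨾ advance r e next

  frame-body : ∀ {τ υ} → Frame body τ υ → Frame loop τ υ
  frame-body = frame-seqʳ {r := start} ∘ frame-seqʳ {e := count} ∘ λ f → mkFrame
      (λ x → var≡ f x ∘ ∨-falseˡ) (λ k → array≡ f k ∘ ∨-falseˡ)

  frame-advance : ∀ {τ υ} → Frame (advance r e next) τ υ → Frame loop τ υ
  frame-advance = frame-seqʳ {r := start} ∘ frame-seqʳ {e := count} ∘ λ f →
    mkFrame (λ x → var≡ f x ∘ ∨-falseʳ {writesVar body x})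
        (λ k → array≡ f k ∘ ∨-falseʳ {writesArray body k})

  go : ∀ xs s {τ} → Frame loop σ τ → Points xs (vars τ r) → vars τ e ≡ length xs → I s τ →
       Runs (while var e loop body′) τ (suc (sum (map w xs))) (I (foldl f s xs))
  go []       s fr pt n i = stop n i
  go (x ∷ xs) s {τ} fr pt n i =
    -- The extra unit stays with the remaining list, where it pays for the final failing test.
    subst (λ k → Runs (while var e loop body′) τ k (I (foldl f (f s x) xs))) (+-suc (w x) _)
      (iter ⦃ w≢0 x ⦄ (λ z → contradiction (trans (sym n) z) λ ())
        (seq (map-post (body-spec fr pt i) λ {υ} fr′ i′ →
          let fr″ = frame-trans fr (frame-body fr′)
              pt′ = point-next fr″ (subst (Points (x ∷ xs)) (sym (var≡ fr′ r body∌r)) pt)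
              σ₁  = setVar υ r (⟦ next ⟧ υ)
          in seq {p = r := next} (assign ⦃ w≢0 x ⦄ (assign ⦃ w≢0 x ⦄ (go xs (f s x)
               (frame-trans fr″ (frame-advance (frame (⇓seq ⇓assign ⇓assign))))
               (subst (Points xs) (sym (trans (update-minimal (vars σ₁) e _ r≢e)
                   (update-updates (vars υ) r _))) pt′)
               (trans (update-updates (vars σ₁) e _)
                 (cong (_∸ 1) (trans (update-minimal (vars υ) r _ e≢r) (trans (var≡ fr′ e body∌e) n))))
               (I-resp _ _ i′)))))))
    where
    e≢r : (e ≡ᵇ r) ≡ false
    e≢r = trans (≡ᵇ-sym e r) r≢e

-- Loops over the input

Holds : (ℕ → ℕ) → ℕ → List ℕ → Set
Holds a p []       = Unit
Holds a p (w ∷ ws) = a p ≡ w × Holds a (suc p) ws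

holds-++⁻ʳ : ∀ {a ws} us {p} → Holds a p (us ++ ws) → Holds a (length us + p) ws
holds-++⁻ʳ []       h = h
holds-++⁻ʳ {a} {ws} (u ∷ us) {p} (_ , h) =
  subst (λ k → Holds a k ws) (+-suc (length us) p) (holds-++⁻ʳ us h)

holds-++⁻ˡ : ∀ {a ws} us {p} → Holds a p (us ++ ws) → Holds a p us
holds-++⁻ˡ []       h = tt
holds-++⁻ˡ (_ ∷ us) (eq , h) = eq , holds-++⁻ˡ us h

holds-++⁺ : ∀ {a ws} us {p} → Holds a p us → Holds a (length us + p) ws → Holds a p (us ++ ws)
holds-++⁺ []       _ h = h
holds-++⁺ {a} {ws} (u ∷ us) {p} (eq , h) h′ =
  eq , holds-++⁺ us h (subst (λ k → Holds a k ws) (sym (+-suc (length us) p)) h′)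

holds-update : ∀ {a} ws {p k v} → k < p ⊎ length ws + p ≤ k → Holds a p ws → Holds (update a k v) p ws
holds-update []       _  h = tt
holds-update {a} (w ∷ ws) {p} {k} k∉ (eq , h) =
  trans (update-minimal-≢ a k _ (p≢k k∉)) eq , holds-update ws (weaken∉ k∉) h
  where
  p≢k : k < p ⊎ suc (length ws + p) ≤ k → p ≢ k
  p≢k (inj₁ lt) refl = <-irrefl refl lt
  p≢k (inj₂ le) refl = <-irrefl refl (≤-trans (s≤s (m≤n+m p (length ws))) le)
  weaken∉ : k < p ⊎ suc (length ws + p) ≤ k → k < suc p ⊎ length ws + suc p ≤ k
  weaken∉ (inj₁ lt) = inj₁ (m<n⇒m<1+n lt)
  weaken∉ (inj₂ le) = inj₂ (≤-trans (≤-reflexive (+-suc (length ws) p)) le)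

holds-at : ∀ ws {a p} → (∀ i → a (p + i) ≡ at ws i) → Holds a p ws
holds-at []       eq = tt
holds-at (w ∷ ws) {a} {p} eq =
  trans (cong a (sym (+-identityʳ p))) (eq 0) ,
  holds-at ws λ i → trans (cong a (sym (+-suc p i))) (eq (suc i))

-- With `id` in place of an array the pointer itself is the datum, so loops over V are instances of
-- `for-spec` like loops over stored lists.
holds-consecutive : ∀ {A : Set} {m p} (f : Fin m → A) (g : A → ℕ) → (∀ i → p + toℕ i ≡ g (f i))
    → Holds id p (map g (tabulate f))
holds-consecutive {m = zero}  f g eq = tt
holds-consecutive {m = suc m} {p} f g eq =
  trans (sym (+-identityʳ p)) (eq zero) ,
  holds-consecutive (f ∘ suc) g λ i → trans (sym (+-suc p (toℕ i))) (eq (suc i))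

does-∈? : ∀ (x : Fin n) S → does (x ∈? S) ≡ lookup S x
does-∈? zero    (true ∷ S)  = refl
does-∈? zero    (false ∷ S) = refl
does-∈? (suc x) (_ ∷ S)     = does-∈? x S

length-members : (S : Subset n) → length (members S) ≡ ∣ S ∣
length-members {zero} [] = refl
length-members {suc n} (b ∷ S) = trans (cong (λ xs → length (filter (_∈? (b ∷ S)) (zero ∷ xs)))
    (sym (map-tabulate id suc))) (head b)
  where
  filter-suc : ∀ b xs → length (filter (_∈? (b ∷ S)) (map suc xs)) ≡ length (filter (_∈? S) xs)
  filter-suc b []       = refl
  filter-suc b (x ∷ xs) with does (x ∈? S)
  ... | true  = cong suc (filter-suc b xs)
  ... | false = filter-suc b xs
  head : ∀ b → length (filter (_∈? (b ∷ S)) (zero ∷ map suc (allFin n))) ≡ ∣ b ∷ S ∣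
  head true  = cong suc (trans (filter-suc true (allFin n)) (length-members S))
  head false = trans (filter-suc false (allFin n)) (length-members S)

sum-const : ∀ {A : Set} W (xs : List A) → sum (map (const W) xs) ≡ length xs * W
sum-const W []       = refl
sum-const W (x ∷ xs) = cong (W +_) (sum-const W xs)

suc-sum-const : ∀ {A : Set} W .⦃ _ : NonZero W ⦄ (xs : List A) {k} → length xs ≡ k →
                suc (sum (map (const W) xs)) ≤ suc k * W
suc-sum-const W xs refl = +-mono-≤ (>-nonZero⁻¹ W) (≤-reflexive (sum-const W xs))

-- Cell 0 of the input holds |V|, cell 1 the number of hyperedges; from cell 2 on follow the
-- hyperedges, each preceded by its size.
forMembers : (q r e : ℕ) → Program → Program
forMembers q r e = for r e (lit 1 ⊕ var q) (0 [ var q ]) (lit 1 ⊕ var r)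

forVertices : (r e : ℕ) → Program → Program
forVertices r e = for r e (lit 0) (0 [ lit 0 ]) (lit 1 ⊕ var r)

forEdges : (r e : ℕ) → Program → Program
forEdges r e = for r e (lit 2) (0 [ lit 1 ]) (lit 1 ⊕ (0 [ var r ] ⊕ var r))

-- The left side of the conclusion is what `writesArray` of a loop reduces to, since the loop
-- control writes no array.
for∌array : ∀ body k → writesArray body k ≡ false → writesArray body k ∨ false ≡ false
for∌array body k eq rewrite eq = refl

EdgeAt : State → ℕ → Subset n → Set
EdgeAt σ q K = Holds (arrays σ 0) (vars σ q) (encodeEdge K)

module _ {S : Set} {r e : ℕ} {body : Program} (r≢e : (r ≡ᵇ e) ≡ false)
         (body∌r : writesVar body r ≡ false) (body∌e : writesVar body e ≡ false)
         (body∌0 : writesArray body 0 ≡ false) where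

  forMembers-spec : ∀ q {K : Subset n} {f : S → Fin n → S} {I : S → State → Set} {W s σ}
    .⦃ _ : NonZero W ⦄ → (q ≡ᵇ r) ≡ false → EdgeAt σ q K →
    (∀ {s σ} a b → I s σ → I s (setVar (setVar σ r a) e b)) →
    (∀ {s x τ} → Frame (forMembers q r e body) σ τ → arrays τ 0 (vars τ r) ≡ toℕ x → I s τ →
                 Runs body τ W (I (f s x))) →
    I s σ → Runs (forMembers q r e body) σ (suc ∣ K ∣ * W) (I (foldl f s (members K)))
  forMembers-spec q {K} {f} {I} {W} {s} {σ} ⦃ nz ⦄ q≢r (size , elems) resp body-spec i =
    weaken (suc-sum-const W (members K) (length-members K))
      (for-spec f I (λ xs p → Holds (arrays σ 0) p (map toℕ xs)) (const W) r≢e body∌r body∌e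
        (λ _ → >-nonZero (>-nonZero⁻¹ W)) resp (λ _ → proj₂)
        (λ {_} {_} {_} {τ} fr pt → body-spec fr (trans
            (cong (λ a → a (vars τ r)) (array≡ fr 0 (for∌array body 0 body∌0))) (proj₁ pt)))
        elems
        (trans (cong (arrays σ 0) (update-minimal (vars σ) r _ q≢r))
            (trans size (sym (length-members K))))
        i)

module Loops {n : ℕ} (𝒦 : Hypergraph n) where

  -- `L` is the length of `encode 𝒦`. In both numbers the extra 1 covers the final test of a loop.
  N L : ℕ
  N = suc n
  L = suc (length 𝒦 + ‖ 𝒦 ‖)

  Input : State → Set
  Input σ = arrays σ 0 ≡ at (n ∷ encode 𝒦)

  module _ {S : Set} {r e : ℕ} {body : Program} (r≢e : (r ≡ᵇ e) ≡ false)
           (body∌r : writesVar body r ≡ false) (body∌e : writesVar body e ≡ false)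
           (body∌0 : writesArray body 0 ≡ false) where

    forVertices-spec : ∀ {f : S → Fin n → S} {I : S → State → Set} {W s σ}
      .⦃ _ : NonZero W ⦄ → Input σ →
      (∀ {s σ} a b → I s σ → I s (setVar (setVar σ r a) e b)) →
      (∀ {s x τ} → Frame (forVertices r e body) σ τ → Input τ → vars τ r ≡ toℕ x → I s τ →
                   Runs body τ W (I (f s x))) →
      I s σ → Runs (forVertices r e body) σ (N * W) (I (foldl f s (allFin n)))
    forVertices-spec {f} {I} {W} {s} {σ} inp resp body-spec i =
      weaken (suc-sum-const W (allFin n) (length-tabulate {n = n} id))
        (for-spec f I (λ xs p → Holds id p (map toℕ xs)) (const W) {xs = allFin n} r≢e body∌r body∌e
          (λ _ → >-nonZero (>-nonZero⁻¹ W)) resp (λ _ → proj₂)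
          (λ fr pt → body-spec fr (trans (array≡ fr 0 (for∌array body 0 body∌0)) inp) (proj₁ pt))
          (holds-consecutive id toℕ (λ _ → refl))
          (trans (cong (λ a → a 0) inp) (sym (length-tabulate {n = n} id)))
          i)

    forEdges-spec : ∀ {f : S → Subset n → S} {I : S → State → Set} (w : Subset n → ℕ) {W s σ} →
      (∀ K → NonZero (w K)) → suc (sum (map w 𝒦)) ≤ W → Input σ →
      (∀ {s σ} a b → I s σ → I s (setVar (setVar σ r a) e b)) →
      (∀ {s K τ} → Frame (forEdges r e body) σ τ → Input τ → EdgeAt τ r K → I s τ →
                   Runs body τ (w K) (I (f s K))) →
      I s σ → Runs (forEdges r e body) σ W (I (foldl f s 𝒦))
    forEdges-spec {f} {I} w {W} {s} {σ} nz fits inp resp body-spec i =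
      weaken fits
        (for-spec f I (λ xs p → Holds (arrays σ 0) p (concatMap encodeEdge xs)) w {xs = 𝒦} r≢e body∌r body∌e
          nz resp
          (λ {K} {xs} {τ} fr h →
            -- The size stored under the pointer gives the distance to the next hyperedge.
            subst (λ k → Holds (arrays σ 0) (suc (k + vars τ r)) (concatMap encodeEdge xs))
              (begin
                length (map toℕ (members K)) ≡⟨ length-map toℕ (members K) ⟩
                length (members K)           ≡⟨ length-members K ⟩
                ∣ K ∣                        ≡⟨ sym (proj₁ h) ⟩
                arrays σ 0 (vars τ r)        ≡⟨ cong (λ a → a (vars τ r)) (sym (keeps-input fr)) ⟩
                arrays τ 0 (vars τ r)        ∎)
              (holds-++⁻ʳ (encodeEdge K) h))
          (λ {_} {K} fr h → body-spec fr (trans (keeps-input fr) inp)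
            (subst (λ a → Holds a _ (encodeEdge K)) (sym (keeps-input fr))
                (holds-++⁻ˡ (encodeEdge K) h)))
          (subst (λ a → Holds a 2 (concatMap encodeEdge 𝒦)) (sym inp)
              (holds-at (concatMap encodeEdge 𝒦) (λ _ → refl)))
          (cong (λ a → a 1) inp)
          i)
      where
      open ≡-Reasoning
      keeps-input : ∀ {τ} → Frame (forEdges r e body) σ τ → arrays τ 0 ≡ arrays σ 0
      keeps-input fr = array≡ fr 0 (for∌array body 0 body∌0)

-- The algorithm as a function on subsets

bit : Bool → ℕ
bit true  = 1
bit false = 0

positive : ℕ → Bool
positive zero    = false
positive (suc _) = true

infix 4 _represents_
record _represents_ (a : ℕ → ℕ) (S : Subset n) : Set where
  constructor pointwise
  field cell≡ : ∀ x → a (toℕ x) ≡ bit (lookup S x)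
open _represents_

lookup-ext : {S T : Subset n} → (∀ x → lookup S x ≡ lookup T x) → S ≡ T
lookup-ext {S = []} {[]} eq = refl
lookup-ext {S = _ ∷ _} {_ ∷ _} eq = cong₂ _∷_ (eq zero) (lookup-ext (eq ∘ suc))

represents-update : ∀ {a} {S : Subset n} {i v} x b → i ≡ toℕ x → v ≡ bit b →
                    a represents S → update a i v represents (S [ x ]≔ b)
represents-update {n} {a} {S} {i} {v} x b refl refl rep = pointwise updated
  where
  updated : ∀ (y : Fin n) → update a i v (toℕ y) ≡ bit (lookup (S [ x ]≔ b) y)
  updated y with x Fin.≟ y
  ... | yes refl = trans (update-updates a i v) (cong bit (sym (lookup∘update x S b)))
  ... | no x≢y   = trans (update-minimal-≢ a i v (x≢y ∘ sym ∘ Fin.toℕ-injective))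
                         (trans (cell≡ rep y) (cong bit (sym (lookup∘update′ (x≢y ∘ sym) S b))))

setAll : (Fin n → Bool) → Subset n → List (Fin n) → Subset n
setAll g = foldl (λ S x → S [ x ]≔ g x)

-- The disjunction is the loop invariant: a cell has its final value already or is still to be
-- visited.
setAll-∈ : ∀ (g : Fin n → Bool) {S} xs {y} → lookup S y ≡ g y ⊎ y List.∈ xs → lookup
    (setAll g S xs) y ≡ g y
setAll-∈ g []       (inj₁ eq) = eq
setAll-∈ g {S} (x ∷ xs) {y} h = setAll-∈ g xs (step h)
  where
  step : lookup S y ≡ g y ⊎ y List.∈ (x ∷ xs) → lookup (S [ x ]≔ g x) y ≡ g y ⊎ y List.∈ xs
  step (inj₂ (here refl)) = inj₁ (lookup∘update x S (g x))
  step (inj₂ (there y∈))  = inj₂ y∈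
  step (inj₁ eq) with y Fin.≟ x
  ... | yes refl = inj₁ (lookup∘update x S (g x))
  ... | no y≢x   = inj₁ (trans (lookup∘update′ y≢x S (g x)) eq)

setAll-∉ : ∀ (g : Fin n → Bool) {S} xs {y} → y List.∉ xs → lookup (setAll g S xs) y ≡ lookup S y
setAll-∉ g []       _  = refl
setAll-∉ g {S} (x ∷ xs) y∉ =
  trans (setAll-∉ g xs (y∉ ∘ there)) (lookup∘update′ (y∉ ∘ here) S (g x))

setAll-allFin : ∀ (g : Fin n → Bool) {S T} → (∀ x → lookup T x ≡ g x) → setAll g S (allFin n) ≡ T
setAll-allFin g eq = lookup-ext λ x → trans (setAll-∈ g (allFin _) (inj₂ (List.∈-allFin x)))
    (sym (eq x))

∈-members⁺ : ∀ {x} {S : Subset n} → x ∈ S → x List.∈ members S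
∈-members⁺ {x = x} {S} = List.∈-filter⁺ (_∈? S) (List.∈-allFin x)

∈-members⁻ : ∀ {x} {S : Subset n} → x List.∈ members S → x ∈ S
∈-members⁻ {S = S} x∈ = proj₂ (List.∈-filter⁻ (_∈? S) {xs = allFin _} x∈)

∉⇒lookup : ∀ {x} {S : Subset n} → x ∉ S → lookup S x ≡ false
∉⇒lookup {x = x} {S} x∉ with lookup S x in eq
... | false = refl
... | true  = contradiction (lookup⇒[]= x S eq) x∉

setAll-members : ∀ b {S T K : Subset n} → (∀ {x} → x ∈ K → lookup T x ≡ b) →
                 (∀ {x} → x ∉ K → lookup S x ≡ lookup T x) → setAll (const b) S (members K) ≡ T
setAll-members b {S} {T} {K} inside outside = lookup-ext agrees
  where
  agrees : ∀ x → lookup (setAll (const b) S (members K)) x ≡ lookup T x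
  agrees x with x ∈? K
  ... | yes x∈ = trans (setAll-∈ (const b) (members K) (inj₂ (∈-members⁺ x∈))) (sym (inside x∈))
  ... | no  x∉ = trans (setAll-∉ (const b) (members K) (x∉ ∘ ∈-members⁻)) (outside x∉)

mark-members : (K : Subset n) → setAll (const true) ⊥ (members K) ≡ K
mark-members K = setAll-members true []=⇒lookup λ {x} x∉ →
  trans (lookup-replicate x false) (sym (∉⇒lookup x∉))

unmark-members : (K : Subset n) → setAll (const false) K (members K) ≡ ⊥
unmark-members K = setAll-members false (λ {x} _ → lookup-replicate x false) λ {x} x∉ →
  trans (∉⇒lookup x∉) (sym (lookup-replicate x false))

module Model {n : ℕ} (𝒦 : Hypergraph n) where

  -- Truncated subtraction serves as negation, so this is the number of elements of `K` outside
  -- `S ∪ M`.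
  missing : Subset n → Subset n → Subset n → ℕ
  missing S M K = foldl (λ k w → k + (1 ∸ (bit (lookup S w) + bit (lookup M w)))) 0 (members K)

  found : Subset n → Subset n → ℕ
  found S M = foldl (λ k K → k + (1 ∸ missing S M K)) 0 𝒦

  -- found S M counts the K ∈ 𝒦 with K ⊆ S ∪ M.  Hence u survives iff some key
  -- avoiding u lies in S ∪ K.
  trial : Subset n → Subset n → Fin n → Subset n
  trial K S u = S [ u ]≔ (lookup S u ∧ positive (found (S [ u ]≔ false) (K [ u ]≔ false)))

  sweepEdge : Subset n → Subset n → Subset n
  sweepEdge S K = foldl (trial K) S (members K)

  sweep : Subset n → Subset n
  sweep S = foldl sweepEdge S 𝒦

  -- A sweep with any effect deletes a vertex, so `n` sweeps end in a set that a further sweep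
  -- leaves alone.
  shrink : Subset n → Subset n
  shrink S = foldl (λ S _ → sweep S) S (allFin n)

  -- The test for `v ∉ T` makes every output pay with a new vertex of `T`, which bounds the number
  -- of hyperedges.
  extend : Subset n × Hypergraph n → Fin n → Subset n × Hypergraph n
  extend (T , ℋ) v =
    if lookup (shrink (T [ v ]≔ true)) v ∧ not (lookup T v)
    then (T [ v ]≔ true , ℋ ∷ʳ shrink (T [ v ]≔ true))
    else (T , ℋ)

  round : Subset n × Hypergraph n → Subset n × Hypergraph n
  round s = foldl extend s (allFin n)

  -- A round with any effect enlarges `T`, so `n` rounds suffice.
  saturate : Subset n × Hypergraph n → Subset n × Hypergraph n
  saturate s = foldl (λ s _ → round s) s (allFin n)

  -- Added up over all keys, so that one zero test tells whether every saturation reached V.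
  deficit : ℕ → Subset n → ℕ
  deficit d T = foldl (λ k v → k + (1 ∸ bit (lookup T v))) d (allFin n)

  perEdge : Hypergraph n × ℕ → Subset n → Hypergraph n × ℕ
  perEdge (ℋ , d) K = proj₂ (saturate (K , ℋ)) , deficit d (proj₁ (saturate (K , ℋ)))

  search : Hypergraph n × ℕ
  search = foldl perEdge ([] , 0) 𝒦

-- The program

-- Scalar variables 0 to 17 are pairs of a loop pointer 2k and its counter 2k + 1:
-- 0 the key K, 2 the round, 4 the vertex v, 6 the sweep, 8 the swept edge and
-- 10 its member u, 12 the tested edge, 14 a member of an edge, 16 a vertex.
missV foundV savedS savedM outEnd outCount outPtr deficitV : ℕ
missV    = 18
foundV   = 19
savedS   = 20
savedM   = 21
outEnd   = 22
outCount = 23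
outPtr   = 24
deficitV = 25

-- Characteristic functions: of the candidate S, of the swept edge, and of T.
Sᴬ Mᴬ Tᴬ : ℕ
Sᴬ = 2
Mᴬ = 3
Tᴬ = 4

checkProgram trialProgram sweepEdgeProgram sweepProgram shrinkProgram : Program
emitProgram extendProgram saturateProgram perEdgeProgram algorithm     : Program

checkProgram =
  foundV := lit 0 ⨾
  forEdges 12 13
    (missV := lit 0 ⨾
     (forMembers 12 14 15
        (missV := var missV ⊕ (lit 1 ⊖ (Sᴬ [ 0 [ var 14 ] ] ⊕ Mᴬ [ 0 [ var 14 ] ]))) ⨾
     foundV := var foundV ⊕ (lit 1 ⊖ var missV)))

trialProgram =
  savedS := Sᴬ [ 0 [ var 10 ] ] ⨾
  (savedM := Mᴬ [ 0 [ var 10 ] ] ⨾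
  (Sᴬ [ 0 [ var 10 ] ]:= lit 0 ⨾
  (Mᴬ [ 0 [ var 10 ] ]:= lit 0 ⨾
  (checkProgram ⨾
  (Mᴬ [ 0 [ var 10 ] ]:= var savedM ⨾
   -- The old bit survives if some key was found and becomes 0 otherwise.
   Sᴬ [ 0 [ var 10 ] ]:= var savedS ⊖ (lit 1 ⊖ var foundV))))))

sweepEdgeProgram =
  forMembers 8 14 15 (Mᴬ [ 0 [ var 14 ] ]:= lit 1) ⨾
  (forMembers 8 10 11 trialProgram ⨾
  forMembers 8 14 15 (Mᴬ [ 0 [ var 14 ] ]:= lit 0))

sweepProgram = forEdges 8 9 sweepEdgeProgram

shrinkProgram = forVertices 6 7 sweepProgram

-- A vertex outside S is written as well, but outPtr does not move past it.
emitProgram =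
  outPtr := lit 1 ⊕ var outEnd ⨾
  (forVertices 16 17
     (1 [ var outPtr ]:= var 16 ⨾ outPtr := Sᴬ [ var 16 ] ⊕ var outPtr) ⨾
  -- The cell at `outEnd` was left free for the size, which is known only now.
  (1 [ var outEnd ]:= var outPtr ⊖ (lit 1 ⊕ var outEnd) ⨾
  (outEnd := var outPtr ⨾
  outCount := lit 1 ⊕ var outCount)))

extendProgram =
  forVertices 16 17 (Sᴬ [ var 16 ]:= Tᴬ [ var 16 ]) ⨾
  (Sᴬ [ var 4 ]:= lit 1 ⨾
  (shrinkProgram ⨾
  -- On bits, this difference is nonzero just for `v` in `S` and outside `T`.
  if Sᴬ [ var 4 ] ⊖ Tᴬ [ var 4 ]
  then Tᴬ [ var 4 ]:= lit 1 ⨾ emitProgram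
  else′ skip))

saturateProgram = forVertices 2 3 (forVertices 4 5 extendProgram)

perEdgeProgram =
  forVertices 16 17 (Tᴬ [ var 16 ]:= lit 0) ⨾
  (forMembers 0 14 15 (Tᴬ [ 0 [ var 14 ] ]:= lit 1) ⨾
  (saturateProgram ⨾
  forVertices 16 17 (deficitV := var deficitV ⊕ (lit 1 ⊖ Tᴬ [ var 16 ]))))

-- The empty 𝒦 is rejected: since V itself spans V, there is always a key.
algorithm =
  -- Cells 0 and 1 of the output are reserved for the answer and the number of hyperedges.
  outEnd := lit 2 ⨾
  (forEdges 0 1 perEdgeProgram ⨾
  (1 [ lit 1 ]:= var outCount ⨾
  -- The value is 1 if `𝒦` is nonempty and the total deficit is 0, and 0 otherwise.
  1 [ lit 0 ]:= (lit 1 ⊖ (lit 1 ⊖ 0 [ lit 1 ])) ⊖ var deficitV))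

-- The program computes the function

module Refinement {n : ℕ} (𝒦 : Hypergraph n) where
  open Model 𝒦
  open Loops 𝒦

  -- Each cell of `encode 𝒦` pays `W`: an element for its pass of the inner loop, a size for the end
  -- of that loop, the leading cell for the end of the outer one.
  edge-weights : ∀ W .⦃ _ : NonZero W ⦄ → suc (sum (map (λ K → suc ∣ K ∣ * W) 𝒦)) ≤ L * W
  edge-weights W = +-mono-≤ (>-nonZero⁻¹ W) (≤-reflexive (go 𝒦))
    where
    open ≡-Reasoning
    go : ∀ 𝒢 → sum (map (λ K → suc ∣ K ∣ * W) 𝒢) ≡ (length 𝒢 + ‖ 𝒢 ‖) * W
    go []      = refl
    go (K ∷ 𝒢) = begin
      W + ∣ K ∣ * W + sum (map (λ K → suc ∣ K ∣ * W) 𝒢) ≡⟨ cong (W + ∣ K ∣ * W +_) (go 𝒢) ⟩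
      suc ∣ K ∣ * W + (length 𝒢 + ‖ 𝒢 ‖) * W            ≡⟨ sym
          (*-distribʳ-+ W (suc ∣ K ∣) (length 𝒢 + ‖ 𝒢 ‖)) ⟩
      suc (∣ K ∣ + (length 𝒢 + ‖ 𝒢 ‖)) * W              ≡⟨ cong (λ k → suc k * W)
          (trans (sym (+-assoc ∣ K ∣ _ _)) (trans (cong (_+ ‖ 𝒢 ‖) (+-comm ∣ K ∣ _))
          (+-assoc (length 𝒢) _ _))) ⟩
      (length (K ∷ 𝒢) + ‖ K ∷ 𝒢 ‖) * W                  ∎

  checkProgram-spec : ∀ {S M σ} → Input σ → arrays σ Sᴬ represents S → arrays σ Mᴬ represents M →
                      Runs checkProgram σ L (λ τ → vars τ foundV ≡ found S M)
  checkProgram-spec {S} {M} inp repS repM =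
    seq (assign (forEdges-spec refl refl refl refl {I = λ k τ → vars τ foundV ≡ k} (λ K → suc ∣ K ∣ * 1)
      (λ _ → _) (≤-trans (edge-weights 1) (≤-reflexive (*-identityʳ L))) inp (λ _ _ i → i)
      (λ {k} {K} {τ} fr inp′ edge i →
        seq (assign (seq (map-post
          (forMembers-spec refl refl refl refl 12 {K = K} {I = λ k τ → vars τ missV ≡ k} refl edge
              (λ _ _ i → i)
            (λ {_} {x} {υ} fr′ elem j → assign (cong₂ (λ a b → a + (1 ∸ b)) j
              (cong₂ _+_
                (trans (cong₂ (λ a i → a i) (trans (array≡ fr′ Sᴬ refl) (array≡ fr Sᴬ refl)) elem)
                    (cell≡ repS x))
                (trans (cong₂ (λ a i → a i) (trans (array≡ fr′ Mᴬ refl) (array≡ fr Mᴬ refl)) elem)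
                    (cell≡ repM x)))))
            refl)
          λ fr′ j → assign (cong₂ (λ a b → a + (1 ∸ b)) (trans (var≡ fr′ foundV refl) i) j)))))
      refl))

  restore-mark : ∀ {a} {K : Subset n} {i} x → i ≡ toℕ x → a represents K →
                 update (update a i 0) i (a i) represents K
  restore-mark {a} {K} x eq rep =
    subst (_ represents_) (trans ([]≔-idempotent K x) ([]≔-lookup K x))
      (represents-update x (lookup K x) eq (trans (cong a eq) (cell≡ rep x))
          (represents-update x false eq refl rep))

  -- The arithmetic of the last store in `trialProgram`, read as a conjunction.
  bit-∧ : ∀ b k → bit b ∸ (1 ∸ k) ≡ bit (b ∧ positive k)
  bit-∧ true  zero    = refl
  bit-∧ true  (suc k) = cong (1 ∸_) (0∸n≡0 k)
  bit-∧ false k       = 0∸n≡0 (1 ∸ k)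

  trialProgram-spec : ∀ {S K u σ} → Input σ → arrays σ 0 (vars σ 10) ≡ toℕ u →
                      arrays σ Sᴬ represents S → arrays σ Mᴬ represents K →
                      Runs trialProgram σ L (λ τ → arrays τ Sᴬ represents trial K S u × arrays τ Mᴬ represents K)
  trialProgram-spec {S} {K} {u} {σ} inp elem repS repK =
    seq (assign (seq (assign (seq (store (seq (store (seq (map-post
      (checkProgram-spec inp (represents-update u false elem refl repS)
          (represents-update u false elem refl repK))
      λ {τ} fr eq →
        let elem′ = trans (cong₂ (λ a i → a i) (array≡ fr 0 refl) (var≡ fr 10 refl)) elem
            i≡    = trans elem′ (sym elem)
        in seq (store (store
          ( subst (_ represents_) ([]≔-idempotent S u)
              (represents-update u _ elem′
                (trans (cong₂ (λ a b → a ∸ (1 ∸ b)) (trans (var≡ fr savedS refl)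
                    (trans (cong (arrays σ Sᴬ) elem) (cell≡ repS u))) eq)
                       (bit-∧ (lookup S u) _))
                (subst (_represents (S [ u ]≔ false)) (sym (array≡ fr Sᴬ refl))
                    (represents-update u false elem refl repS)))
          , subst (_represents K)
              (cong₂ (λ (a , i) v → update a i v) (cong₂ _,_ (sym (array≡ fr Mᴬ refl)) (sym i≡))
                  (sym (var≡ fr savedM refl)))
              (restore-mark u elem repK)))))))))))))

  -- The mark array is empty before and after. Unmarking just the members of `K` keeps the cost of
  -- an edge proportional to its size and not to |V|.
  sweepEdgeProgram-spec : ∀ {S K σ} → Input σ → EdgeAt σ 8 K →
    arrays σ Sᴬ represents S → arrays σ Mᴬ represents (⊥ {n}) →
    Runs sweepEdgeProgram σ (suc ∣ K ∣ * L) (λ τ → arrays τ Sᴬ represents sweepEdge S K × arrays τ Mᴬ represents (⊥ {n}))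
  sweepEdgeProgram-spec {S} {K} {σ} inp edge repS repM =
    seq (map-post
      (forMembers-spec refl refl refl refl 8 {K = K} {I = λ M τ
          → arrays τ Mᴬ represents M} refl edge (λ _ _ i → i)
        (λ {_} {x} _ elem i → store (represents-update x true elem refl i)) repM)
      λ {τ} fr marked → seq (map-post
        (forMembers-spec refl refl refl refl 8 {K = K}
          {I = λ S τ → arrays τ Sᴬ represents S × arrays τ Mᴬ represents K} refl
          (keeps-edge fr) (λ _ _ i → i)
          (λ {S} {x} fr′ elem (repS , repM) → trialProgram-spec
              (trans (array≡ fr′ 0 refl) (trans (array≡ fr 0 refl) inp)) elem repS repM)
          (subst (_represents S) (sym (array≡ fr Sᴬ refl)) repS , subst (_ represents_)
              (mark-members K) marked))
        λ {υ} fr′ (repS , repM) → map-post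
          (forMembers-spec refl refl refl refl 8 {K = K}
            {I = λ M τ → arrays τ Mᴬ represents M} refl
            (subst₂ (λ a p → Holds a p (encodeEdge K)) (sym (array≡ fr′ 0 refl))
                (sym (var≡ fr′ 8 refl)) (keeps-edge fr)) (λ _ _ i → i)
            (λ {_} {x} _ elem i → store (represents-update x false elem refl i)) repM)
          λ fr″ unmarked → subst (_represents sweepEdge S K) (sym (array≡ fr″ Sᴬ refl)) repS , subst
              (_ represents_) (unmark-members K) unmarked))
    where
    keeps-edge : ∀ {τ} → Frame (forMembers 8 14 15 (Mᴬ [ 0 [ var 14 ] ]:= lit 1)) σ τ → EdgeAt τ 8 K
    keeps-edge fr = subst₂ (λ a p → Holds a p (encodeEdge K)) (sym (array≡ fr 0 refl))
        (sym (var≡ fr 8 refl)) edge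

  -- `W₁` is for one sweep: fewer than `L` trials, each a scan of `𝒦` within `L`. `W₂` is for a
  -- whole `shrink`.
  W₁ W₂ : ℕ
  W₁ = L * L
  W₂ = N * W₁

  sweepProgram-spec : ∀ {S σ} → Input σ → arrays σ Sᴬ represents S → arrays σ Mᴬ represents (⊥ {n}) →
    Runs sweepProgram σ W₁ (λ τ → arrays τ Sᴬ represents sweep S × arrays τ Mᴬ represents (⊥ {n}))
  sweepProgram-spec inp repS repM =
    forEdges-spec refl refl refl refl {I = λ S τ → arrays τ Sᴬ represents S × arrays τ Mᴬ represents
        (⊥ {n})}
      (λ K → suc ∣ K ∣ * L) (λ _ → _) (edge-weights L) inp (λ _ _ i → i)
      (λ _ inp′ edge (repS , repM) → sweepEdgeProgram-spec inp′ edge repS repM)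
      (repS , repM)

  shrinkProgram-spec : ∀ {S σ} → Input σ → arrays σ Sᴬ represents S → arrays σ Mᴬ represents (⊥ {n}) →
    Runs shrinkProgram σ W₂ (λ τ → arrays τ Sᴬ represents shrink S × arrays τ Mᴬ represents (⊥ {n}))
  shrinkProgram-spec inp repS repM =
    forVertices-spec refl refl refl refl {I = λ S τ
        → arrays τ Sᴬ represents S × arrays τ Mᴬ represents (⊥ {n})}
      inp (λ _ _ i → i) (λ _ inp′ _ (repS , repM) → sweepProgram-spec inp′ repS repM) (repS , repM)

  -- Cells from `outEnd` on are left open, since a vertex outside the last set may have been written
  -- there. The 2 stands for the two reserved cells.
  record Emitted (τ : State) (ℋ : Hypergraph n) : Set where
    constructor emitted
    field
      code≡  : Holds (arrays τ 1) 2 (concatMap encodeEdge ℋ)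
      end≡   : vars τ outEnd ≡ length (concatMap encodeEdge ℋ) + 2
      count≡ : vars τ outCount ≡ length ℋ

  keepIf : Subset n → List (Fin n) → Fin n → List (Fin n)
  keepIf S ds v = if lookup S v then ds ∷ʳ v else ds

  -- Turns the accumulating loop into the `filter` by which `members` is defined.
  foldl-keepIf : ∀ S ds xs → foldl (keepIf S) ds xs ≡ ds ++ filter (_∈? S) xs
  foldl-keepIf S ds []       = sym (++-identityʳ ds)
  foldl-keepIf S ds (x ∷ xs) rewrite sym (does-∈? x S) with does (x ∈? S)
  ... | true  = trans (foldl-keepIf S (ds ∷ʳ x) xs) (++-assoc ds _ _)
  ... | false = foldl-keepIf S ds xs

  emitProgram-spec : ∀ {S ℋ σ} → Input σ → arrays σ Sᴬ represents S → Emitted σ ℋ →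
                     Runs emitProgram σ W₂ (λ τ → Emitted τ (ℋ ∷ʳ S))
  emitProgram-spec {S} {ℋ} {σ} inp repS (emitted code≡ end≡ count≡) =
    seq (assign (seq (map-post
      (forVertices-spec refl refl refl refl {f = keepIf S} {I = Writing} inp (λ _ _ i → i)
        (λ {ds} {x} {τ} fr _ x≡ (old , new , ptr) →
          let S-x    = trans (cong₂ (λ a i → a i) (array≡ fr Sᴬ refl) x≡) (cell≡ repS x)
              old′   = holds-update ws (inj₂ (≤-trans (≤-trans (n≤1+n _)
                  (m≤n+m (suc o) (length (map toℕ ds)))) (≤-reflexive (sym ptr)))) old
              new′   = holds-update (map toℕ ds) (inj₂ (≤-reflexive (sym ptr))) new
          in seq (store (assign (old′ , write ds x new′ (trans
              (update-updates (arrays τ 1) (vars τ outPtr) (vars τ 16)) x≡) ptr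
              (cong (_+ vars τ outPtr) S-x)))))
        (code≡ , tt , cong suc end≡))
      λ {τ} fr (old , new , ptr) →
        let e≡ : vars τ outEnd ≡ o
            e≡ = trans (var≡ fr outEnd refl) end≡
        in seq (store (seq (assign (assign (finish (subst (λ ds → Writing ds τ)
            (foldl-keepIf S [] (allFin n)) (old , new , ptr))
             e≡ (trans (var≡ fr outCount refl) count≡)))))))))
    where
    ws = concatMap encodeEdge ℋ
    o = length ws + 2
    -- The elements start at `suc o`; cell `o` is kept for the size.
    Writing : List (Fin n) → State → Set
    Writing ds τ = Holds (arrays τ 1) 2 ws × Holds (arrays τ 1) (suc o) (map toℕ ds) ×
                   vars τ outPtr ≡ length (map toℕ ds) + suc o
    write : ∀ {a p p′} ds x → Holds a (suc o) (map toℕ ds) → a p ≡ toℕ x → p ≡ length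
        (map toℕ ds) + suc o →
            p′ ≡ bit (lookup S x) + p →
            Holds a (suc o) (map toℕ (keepIf S ds x)) × p′ ≡ length (map toℕ (keepIf S ds x)) + suc o
    write {a} {p} ds x h eq ptr ptr′ with lookup S x
    ... | false = h , trans ptr′ ptr
    ... | true rewrite map-++ toℕ ds (x ∷ []) =
      holds-++⁺ (map toℕ ds) h (trans (cong a (sym ptr)) eq , tt) ,
      trans ptr′ (trans (cong suc ptr) (cong (_+ suc o)
          (sym (trans (length-++ (map toℕ ds)) (+-comm _ 1)))))

    finish : ∀ {τ} → Writing (members S) τ → vars τ outEnd ≡ o → vars τ outCount ≡ length ℋ →
             Emitted (setVar (setVar (setCell τ 1 (vars τ outEnd) (vars τ outPtr ∸ suc (vars τ outEnd)))
                        outEnd (vars τ outPtr)) outCount (suc (vars τ outCount))) (ℋ ∷ʳ S)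
    finish {τ} (old , new , ptr) e≡ c≡ = emitted
      (subst (Holds (update (arrays τ 1) (vars τ outEnd) size) 2) (sym code-snoc)
        (holds-++⁺ ws (holds-update ws (inj₂ (≤-reflexive (sym e≡))) old)
          ( trans (cong (update (arrays τ 1) (vars τ outEnd) size) (sym e≡))
              (trans (update-updates (arrays τ 1) (vars τ outEnd) size) size≡)
          , holds-update (map toℕ (members S)) (inj₁ (s≤s (≤-reflexive e≡))) new)))
      (begin
        vars τ outPtr                                     ≡⟨ ptr ⟩
        length (map toℕ (members S)) + suc o              ≡⟨ +-suc _ o ⟩
        length (encodeEdge S) + (length ws + 2)           ≡⟨ sym (+-assoc (length (encodeEdge S)) _ 2) ⟩
        length (encodeEdge S) + length ws + 2             ≡⟨ cong (_+ 2)
            (+-comm (length (encodeEdge S)) _) ⟩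
        length ws + length (encodeEdge S) + 2             ≡⟨ cong (_+ 2) (sym (length-++ ws)) ⟩
        length (ws ++ encodeEdge S) + 2                   ≡⟨ cong (λ us → length us + 2)
            (sym code-snoc) ⟩
        length (concatMap encodeEdge (ℋ ∷ʳ S)) + 2        ∎)
      (trans (cong suc c≡) (sym (trans (length-++ ℋ) (+-comm (length ℋ) 1))))
      where
      open ≡-Reasoning
      size : ℕ
      size = vars τ outPtr ∸ suc (vars τ outEnd)
      size≡ : size ≡ ∣ S ∣
      size≡ = begin
        size                                             ≡⟨ cong₂ (λ a b → a ∸ suc b) ptr e≡ ⟩
        length (map toℕ (members S)) + suc o ∸ suc o     ≡⟨ m+n∸n≡m _ (suc o) ⟩
        length (map toℕ (members S))                     ≡⟨ length-map toℕ (members S) ⟩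
        length (members S)                               ≡⟨ length-members S ⟩
        ∣ S ∣                                            ∎
      code-snoc : concatMap encodeEdge (ℋ ∷ʳ S) ≡ ws ++ encodeEdge S
      code-snoc = trans (concatMap-++ encodeEdge ℋ (S ∷ []))
          (cong (ws ++_) (++-identityʳ (encodeEdge S)))

  emitted-keep : ∀ {σ τ ℋ} → arrays τ 1 ≡ arrays σ 1 → vars τ outEnd ≡ vars σ outEnd →
                 vars τ outCount ≡ vars σ outCount → Emitted σ ℋ → Emitted τ ℋ
  emitted-keep {ℋ = ℋ} a e c (emitted code≡ end≡ count≡) =
    emitted (subst (λ a → Holds a 2 (concatMap encodeEdge ℋ)) (sym a) code≡) (trans e end≡)
        (trans c count≡)

  -- `scratch` is whatever candidate is left in `Sᴬ`; the next extension overwrites it with `T`.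
  record Extending (s : Subset n × Hypergraph n) (τ : State) : Set where
    constructor extending
    field
      {scratch} : Subset n
      repS : arrays τ Sᴬ represents scratch
      repM : arrays τ Mᴬ represents (⊥ {n})
      repT : arrays τ Tᴬ represents proj₁ s
      out  : Emitted τ (proj₂ s)

  W₃ W₄ : ℕ
  W₃ = N * W₂
  W₄ = N * W₃

  bit-∸ : ∀ b c → bit b ∸ bit c ≡ bit (b ∧ not c)
  bit-∸ true  true  = refl
  bit-∸ true  false = refl
  bit-∸ false true  = refl
  bit-∸ false false = refl

  extendProgram-spec : ∀ {s v σ} → Input σ → vars σ 4 ≡ toℕ v → Extending s σ →
                       Runs extendProgram σ W₂ (Extending (extend s v))
  extendProgram-spec {T , ℋ} {v} {σ} inp v≡ (extending repS repM repT out) =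
    seq (map-post
      -- Each copied bit is granted `W₁`, so that the loop matches the budget `W₂` shared by the
      -- whole sequence.
      (forVertices-spec refl refl refl refl {I = λ S τ → arrays τ Sᴬ represents S} {W = W₁} inp
          (λ _ _ i → i)
        (λ {_} {x} {τ} fr _ x≡ i → store (represents-update x (lookup T x) x≡
           (trans (cong₂ (λ a i → a i) (array≡ fr Tᴬ refl) x≡) (cell≡ repT x)) i))
        repS)
      λ {τ} fr copied → seq (store (seq (map-post
        (shrinkProgram-spec (trans (array≡ fr 0 refl) inp)
          (represents-update v true (trans (var≡ fr 4 refl) v≡) refl
              (subst (_ represents_) (setAll-allFin (lookup T) (λ _ → refl)) copied))
          (subst (_represents ⊥) (sym (array≡ fr Mᴬ refl)) repM))
        λ {υ} fr′ (repS′ , repM′) →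
          let v≡′  = trans (var≡ fr′ 4 refl) (trans (var≡ fr 4 refl) v≡)
              repT′ = subst (_represents T) (sym (trans (array≡ fr′ Tᴬ refl) (array≡ fr Tᴬ refl))) repT
              out′ = emitted-keep (trans (array≡ fr′ 1 refl) (array≡ fr 1 refl))
                       (trans (var≡ fr′ outEnd refl) (var≡ fr outEnd refl))
                       (trans (var≡ fr′ outCount refl) (var≡ fr outCount refl)) out
              test : arrays υ Sᴬ (vars υ 4) ∸ arrays υ Tᴬ (vars υ 4) ≡ bit chosen
              test = trans (cong₂ _∸_ (trans (cong (arrays υ Sᴬ) v≡′) (cell≡ repS′ v))
                  (trans (cong (arrays υ Tᴬ) v≡′) (cell≡ repT′ v)))
                           (bit-∸ (lookup S′ v) (lookup T v))
          in branch
            (λ nz → subst (λ s → Runs _ υ W₂ (Extending s))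
                (cong (if_then (T [ v ]≔ true , ℋ ∷ʳ S′) else (T , ℋ))
                (sym (bit≢0 chosen (nz ∘ trans test))))
              (seq (store (map-post
                (emitProgram-spec (trans (array≡ fr′ 0 refl) (trans (array≡ fr 0 refl) inp)) repS′
                    (emitted-keep refl refl refl out′))
                λ {ω} fr″ out″ → extending
                  (subst (_represents S′) (sym (array≡ fr″ Sᴬ refl)) repS′)
                  (subst (_represents ⊥) (sym (array≡ fr″ Mᴬ refl)) repM′)
                  (subst (_represents (T [ v ]≔ true)) (sym (array≡ fr″ Tᴬ refl))
                      (represents-update v true v≡′ refl repT′))
                  out″))))
            (λ z → subst (λ s → Runs _ υ W₂ (Extending s))
                (cong (if_then (T [ v ]≔ true , ℋ ∷ʳ S′) else (T , ℋ))
                (sym (bit≡0 chosen (trans (sym test) z))))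
              (skipR (extending repS′ repM′ repT′ out′)))))))
    where
    S′ : Subset n
    S′ = shrink (T [ v ]≔ true)
    chosen : Bool
    chosen = lookup S′ v ∧ not (lookup T v)
    bit≡0 : ∀ b → bit b ≡ 0 → b ≡ false
    bit≡0 false _ = refl
    bit≢0 : ∀ b → bit b ≢ 0 → b ≡ true
    bit≢0 true  _  = refl
    bit≢0 false ≢0 = contradiction refl ≢0

  saturateProgram-spec : ∀ {s σ} → Input σ → Extending s σ → Runs saturateProgram σ W₄
      (Extending (saturate s))
  saturateProgram-spec inp i =
    forVertices-spec refl refl refl refl {I = Extending} inp
      (λ _ _ (extending a b c (emitted d e f)) → extending a b c (emitted d e f))
      (λ _ inp′ _ i′ → forVertices-spec refl refl refl refl {I = Extending} inp′
        (λ _ _ (extending a b c (emitted d e f)) → extending a b c (emitted d e f))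
        (λ _ inp″ v≡ i″ → extendProgram-spec inp″ v≡ i″) i′) i

  record Searching (s : Hypergraph n × ℕ) (τ : State) : Set where
    constructor searching
    field
      {reached} : Subset n
      current   : Extending (reached , proj₁ s) τ
      deficit≡  : vars τ deficitV ≡ proj₂ s

  W₂≤W₄ : W₂ ≤ W₄
  W₂≤W₄ = ≤-trans (m≤n*m W₂ N) (m≤n*m W₃ N)

  N*k≤W₄ : ∀ {k} → k ≤ N → k * 1 ≤ W₄
  N*k≤W₄ k≤N = ≤-trans (*-mono-≤ k≤N (s≤s z≤n)) W₂≤W₄

  perEdgeProgram-spec : ∀ {s K σ} → Input σ → EdgeAt σ 0 K → Searching s σ →
                        Runs perEdgeProgram σ W₄ (Searching (perEdge s K))
  perEdgeProgram-spec {ℋ , d} {K} {σ} inp edge (searching (extending repS repM repT out) deficit≡) =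
    seq (map-post
      (weaken W₂≤W₄ (forVertices-spec refl refl refl refl {I = λ T τ
          → arrays τ Tᴬ represents T} {W = W₁} inp (λ _ _ i → i)
        (λ {_} {x} fr _ x≡ i → store (represents-update x false x≡ refl i)) repT))
      λ {τ} fr cleared → seq (map-post
        (weaken (N*k≤W₄ (s≤s (∣p∣≤n K))) (forMembers-spec refl refl refl refl 0 {K = K} {I = λ T τ
            → arrays τ Tᴬ represents T} refl
          (subst₂ (λ a p → Holds a p (encodeEdge K)) (sym (array≡ fr 0 refl))
              (sym (var≡ fr 0 refl)) edge) (λ _ _ i → i)
          (λ {_} {x} _ elem i → store (represents-update x true elem refl i))
          (subst (_ represents_) (setAll-allFin (const false)
              (λ x → lookup-replicate x false)) cleared)))
        λ {υ} fr′ filled → seq (map-post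
          (saturateProgram-spec (trans (array≡ fr′ 0 refl) (trans (array≡ fr 0 refl) inp))
            (extending
              (subst (_represents _) (sym (trans (array≡ fr′ Sᴬ refl) (array≡ fr Sᴬ refl))) repS)
              (subst (_represents _) (sym (trans (array≡ fr′ Mᴬ refl) (array≡ fr Mᴬ refl))) repM)
              (subst (_ represents_) (mark-members K) filled)
              (emitted-keep (trans (array≡ fr′ 1 refl) (array≡ fr 1 refl))
                (trans (var≡ fr′ outEnd refl) (var≡ fr outEnd refl))
                (trans (var≡ fr′ outCount refl) (var≡ fr outCount refl)) out)))
          λ {ω} fr″ (extending repS′ repM′ repT′ out′) → map-post
            (weaken W₂≤W₄ (forVertices-spec refl refl refl refl {I = λ d τ
                → vars τ deficitV ≡ d} {W = W₁}
              (trans (array≡ fr″ 0 refl) (trans (array≡ fr′ 0 refl) (trans (array≡ fr 0 refl) inp)))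
                  (λ _ _ i → i)
              (λ {_} {x} fr₃ _ x≡ i → assign (cong₂ (λ k c → k + (1 ∸ c)) i
                (trans (cong₂ (λ a i → a i) (array≡ fr₃ Tᴬ refl) x≡) (cell≡ repT′ x))))
              (trans (var≡ fr″ deficitV refl) (trans (var≡ fr′ deficitV refl)
                  (trans (var≡ fr deficitV refl) deficit≡)))))
            λ fr₃ deficit≡′ → searching
              (extending
                (subst (_represents _) (sym (array≡ fr₃ Sᴬ refl)) repS′)
                (subst (_represents _) (sym (array≡ fr₃ Mᴬ refl)) repM′)
                (subst (_represents _) (sym (array≡ fr₃ Tᴬ refl)) repT′)
                (emitted-keep (array≡ fr₃ 1 refl) (var≡ fr₃ outEnd refl) (var≡ fr₃ outCount refl) out′))
              deficit≡′)))

  W₅ : ℕ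
  W₅ = suc (length 𝒦) * W₄

  answer : ℕ
  answer = 1 ∸ (1 ∸ length 𝒦) ∸ proj₂ search

  algorithm-spec : Runs algorithm (initial 𝒦) W₅
    (λ τ → Holds (arrays τ 1) 0 (answer ∷ encode (proj₁ search)))
  algorithm-spec =
    seq (assign (seq (map-post
      (forEdges-spec refl refl refl refl {I = Searching} (const W₄) (λ _ → _)
          (suc-sum-const W₄ 𝒦 refl) refl
        (λ _ _ (searching (extending a b c (emitted d e f)) g) → searching
            (extending a b c (emitted d e f)) g)
        (λ _ inp edge i → perEdgeProgram-spec inp edge i)
        -- All cells are 0 at the start, so the three arrays represent the empty set.
        (searching (extending zeros zeros zeros (emitted tt refl refl)) refl))
      λ {τ} fr (searching (extending _ _ _ (emitted code≡ end≡ count≡)) deficit≡) →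
        seq (store (store
          ( cong₂ (λ a b → 1 ∸ (1 ∸ a) ∸ b) (cong (λ a → a 1) (array≡ fr 0 refl)) deficit≡
          , count≡
          , holds-update (concatMap encodeEdge (proj₁ search)) (inj₁ (s≤s z≤n))
              (holds-update (concatMap encodeEdge (proj₁ search)) (inj₁ (s≤s (s≤s z≤n))) code≡)))))))
    where
    zeros : (λ _ → 0) represents (⊥ {n})
    zeros = pointwise λ x → cong bit (sym (lookup-replicate x false))

-- Subsets and folds

∈-update⁺ : ∀ {x u b} {S : Subset n} → x ≢ u → x ∈ S → x ∈ S [ u ]≔ b
∈-update⁺ {x = x} {u} {S = S} x≢u = []≔-minimal S x u x≢u

∈-update⁻ : ∀ {x u b} {S : Subset n} → x ≢ u → x ∈ S [ u ]≔ b → x ∈ S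
∈-update⁻ {x = x} {u} {b} {S} x≢u x∈ =
  lookup⇒[]= x S (trans (sym (lookup∘update′ x≢u S b)) ([]=⇒lookup x∈))

∉-remove : ∀ {u} {S : Subset n} → u ∉ S [ u ]≔ false
∉-remove {u = u} {S} u∈ with trans (sym (lookup∘update u S false)) ([]=⇒lookup u∈)
... | ()

⊆-insert : ∀ {u} {S : Subset n} → S ⊆ S [ u ]≔ true
⊆-insert {u = u} {S} {x} x∈ with x Fin.≟ u
... | yes refl = []≔-updates S u
... | no x≢u   = ∈-update⁺ x≢u x∈

remove-⊆ : ∀ {u} {S : Subset n} → S [ u ]≔ false ⊆ S
remove-⊆ {u = u} {S} {x} x∈ with x Fin.≟ u
... | yes refl = contradiction x∈ ∉-remove
... | no x≢u   = ∈-update⁻ x≢u x∈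

insert-grows : ∀ {u} {S : Subset n} → u ∉ S → ∣ S ∣ < ∣ S [ u ]≔ true ∣
insert-grows {u = u} {S} u∉ = p⊂q⇒∣p∣<∣q∣ (⊆-insert , u , []≔-updates S u , u∉)

remove-shrinks : ∀ {u} {S : Subset n} → u ∈ S → ∣ S [ u ]≔ false ∣ < ∣ S ∣
remove-shrinks {u = u} u∈ = p⊂q⇒∣p∣<∣q∣ (remove-⊆ , u , u∈ , ∉-remove)

module _ (f : S → A → S) where

  foldl-preserves : ∀ (P : S → Set) xs → (∀ {s x} → x List.∈ xs → P s → P (f s x)) →
                    ∀ {s} → P s → P (foldl f s xs)
  foldl-preserves P []       step p = p
  foldl-preserves P (x ∷ xs) step p = foldl-preserves P xs (step ∘ there) (step (here refl) p)

  module _ (rank : S → ℕ) where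

    Progressive : Set
    Progressive = ∀ s x → f s x ≡ s ⊎ rank s < rank (f s x)

    foldl-progress : Progressive → ∀ xs s → foldl f s xs ≡ s ⊎ rank s < rank (foldl f s xs)
    foldl-progress prog []       s = inj₁ refl
    foldl-progress prog (x ∷ xs) s with prog s x | foldl-progress prog xs (f s x)
    ... | inj₁ eq | inj₁ eq′ = inj₁ (trans eq′ eq)
    ... | inj₁ eq | inj₂ lt  = inj₂ (subst (λ t → rank t < rank (foldl f (f s x) xs)) eq lt)
    ... | inj₂ lt | inj₁ eq′ = inj₂ (subst (λ t → rank s < rank t) (sym eq′) lt)
    ... | inj₂ lt | inj₂ lt′ = inj₂ (<-trans lt lt′)

    -- A step that changed the state would raise the rank, and later steps never lower it, so the
    -- fold could not return to `s`.
    foldl-fixed : Progressive → ∀ xs {s} → foldl f s xs ≡ s → ∀ {x} → x List.∈ xs → f s x ≡ s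
    foldl-fixed prog (y ∷ ys) {s} fixed x∈ with prog s y | foldl-progress prog ys (f s y)
    foldl-fixed prog (y ∷ ys) {s} fixed (here refl) | inj₁ eq | _ = eq
    foldl-fixed prog (y ∷ ys) {s} fixed (there x∈)  | inj₁ eq | _ =
      foldl-fixed prog ys (trans (cong (λ t → foldl f t ys) (sym eq)) fixed) x∈
    ... | inj₂ lt | inj₁ eq  = contradiction (cong rank (trans (sym fixed) eq)) (<⇒≢ lt)
    ... | inj₂ lt | inj₂ lt′ = contradiction (cong rank (sym fixed)) (<⇒≢ (<-trans lt lt′))

-- Before a fixed point is reached each application gains rank, and there are at least as many
-- applications as the rank allows gains.
iterate-fixed : (f : S → S) (rank : S → ℕ) {m : ℕ} → (∀ s → f s ≡ s ⊎ rank s < rank (f s)) →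
                (∀ s → rank s ≤ m) → ∀ (xs : List A) → m ≤ length xs → ∀ s →
                f (foldl (λ s _ → f s) s xs) ≡ foldl (λ s _ → f s) s xs
iterate-fixed f rank {m} prog bounded xs m≤ s with run xs s
  where
  -- Without a fixed point at the end, every single pass must have gained rank.
  run : ∀ xs s → let t = foldl (λ s _ → f s) s xs in f t ≡ t ⊎ rank s + length xs ≤ rank t
  run []       s = inj₂ (≤-reflexive (+-identityʳ (rank s)))
  run (x ∷ xs) s with prog s | run xs (f s)
  ... | _       | inj₁ fixed = inj₁ fixed
  ... | inj₂ lt | inj₂ le    = inj₂ (≤-trans (≤-reflexive (+-suc (rank s) _))
      (≤-trans (+-monoˡ-≤ (length xs) lt) le))
  ... | inj₁ eq | _          = inj₁ (stays xs eq)
    where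
    stays : ∀ xs {s} → f s ≡ s → let t = foldl (λ s _ → f s) (f s) xs in f t ≡ t
    stays []       eq = cong f eq
    stays (x ∷ xs) eq = stays xs (cong f eq)
... | inj₁ fixed = fixed
-- The rank is now at least `m`, so one more gain is impossible.
... | inj₂ le with prog (foldl (λ s _ → f s) s xs)
...   | inj₁ fixed = fixed
...   | inj₂ lt    = contradiction (≤-trans lt (bounded _))
    (≤⇒≯ (≤-trans m≤ (≤-trans (m≤n+m _ (rank s)) le)))

module _ (g : A → ℕ) where

  sum≡0⁻ : ∀ xs {k} → foldl (λ k x → k + g x) k xs ≡ 0 → k ≡ 0 × (∀ {x} → x List.∈ xs → g x ≡ 0)
  sum≡0⁻ []       eq = eq , λ ()
  sum≡0⁻ (x ∷ xs) {k} eq with sum≡0⁻ xs eq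
  ... | kx≡0 , rest = m+n≡0⇒m≡0 k kx≡0 , λ where
    (here refl) → m+n≡0⇒n≡0 k kx≡0
    (there x∈)  → rest x∈

  sum≡0⁺ : ∀ xs {k} → k ≡ 0 → (∀ {x} → x List.∈ xs → g x ≡ 0) → foldl (λ k x → k + g x) k xs ≡ 0
  sum≡0⁺ []       k≡0 zeros = k≡0
  sum≡0⁺ (x ∷ xs) k≡0 zeros = sum≡0⁺ xs (cong₂ _+_ k≡0 (zeros (here refl))) (zeros ∘ there)

infix 4 _≟ˢ_
_≟ˢ_ : DecidableEquality (Subset n)
_≟ˢ_ = ≡-dec Bool._≟_

-- Hypergraph Horn functions

-- The true sets of `Φ ℋ`, with `H - v ⊆ T` spelled out elementwise.
Closed : Hypergraph n → Subset n → Set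
Closed ℋ T = ∀ {H v} → H List.∈ ℋ → v ∈ H → (∀ {w} → w ∈ H → w ≢ v → w ∈ T) → v ∈ T

clause⁻ : ∀ (c : Clause n) {Z} → IsTrue (⟦ c ⟧ᶜ Z) → Clause.body c ⊆ Z → Clause.head c ∈ Z
clause⁻ (clause B v _) t B⊆ with toWitness t
... | inj₁ B⊈  = contradiction (λ {x} → B⊆ {x}) B⊈
... | inj₂ Bv⊆ = Bv⊆ (x∈p∪q⁺ (inj₂ (x∈⁅x⁆ v)))

clause⁺ : ∀ (c : Clause n) {Z} → (Clause.body c ⊆ Z → Clause.head c ∈ Z) → IsTrue (⟦ c ⟧ᶜ Z)
clause⁺ (clause B v _) {Z} imp with B ⊆? Z
... | no _ = _
... | yes B⊆ with (B ∪ ⁅ v ⁆) ⊆? Z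
...   | yes _ = _
...   | no ⊈ = ⊈ λ x∈ → [ B⊆ , (λ x∈v → subst (_∈ Z) (sym (x∈⁅y⁆⇒x≡y v x∈v)) (imp B⊆)) ]′
    (x∈p∪q⁻ B ⁅ v ⁆ x∈)

trueSet⇒closed : ∀ {ℋ : Hypergraph n} {Z} → TrueSet (Φ ℋ) Z → Closed ℋ Z
trueSet⇒closed {ℋ = ℋ} {Z} holds {H} {v} H∈ v∈ rest =
  clause⁻ (clause (H - v) v (x∉p-x v H))
    (All.lookup (All.all⁺ (λ c → ⟦ c ⟧ᶜ Z) _ (Equivalence.from Bool.T-≡ holds))
      (List.∈-concat⁺′ (List.∈-map⁺ _ (∈-members⁺ v∈)) (List.∈-map⁺ edgeClauses H∈)))
    λ {w} w∈ → rest (p─q⊆p H ⁅ v ⁆ w∈) λ { refl → x∉p-x v H w∈ }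

closed⇒trueSet : ∀ {ℋ : Hypergraph n} {Z} → Closed ℋ Z → TrueSet (Φ ℋ) Z
closed⇒trueSet {ℋ = ℋ} {Z} closed =
  Equivalence.to Bool.T-≡ (All.all⁻ (λ c → ⟦ c ⟧ᶜ Z) (All.tabulate λ {c} c∈ → holds c c∈))
  where
  holds : ∀ c → c List.∈ concatMap edgeClauses ℋ → IsTrue (⟦ c ⟧ᶜ Z)
  holds c c∈ with List.∈-concat⁻′ (map edgeClauses ℋ) c∈
  ... | cs , c∈cs , cs∈ with List.∈-map⁻ edgeClauses cs∈
  ... | H , H∈ , refl with List.∈-map⁻ _ c∈cs
  ... | v , v∈ , refl = clause⁺ (clause (H - v) v (x∉p-x v H)) λ H-v⊆Z →
    closed H∈ (∈-members⁻ v∈) λ w∈ w≢v → H-v⊆Z (x∈p∧x≢y⇒x∈p-y w∈ w≢v)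

-- For `h ≗ Φ ℋ` this expresses `𝕋_h(X) = V` through closed sets.
Spans : Hypergraph n → Subset n → Set
Spans ℋ X = ∀ {Z} → Closed ℋ Z → X ⊆ Z → ∀ y → y ∈ Z

generates⇒spans : ∀ {h} {ℋ : Hypergraph n} {X} → h ≗ Φ ℋ → Generates h X → Spans ℋ X
generates⇒spans {X = X} h≗Φ gen {Z} closed X⊆Z y =
  SmallestTrueSet.smallest gen Z (trans (h≗Φ Z) (closed⇒trueSet closed)) X⊆Z ∈⊤

spans⇒generates : ∀ {h} {ℋ : Hypergraph n} {X} → h ≗ Φ ℋ → Spans ℋ X → Generates h X
spans⇒generates {ℋ = ℋ} h≗Φ spans = record
  { isTrue   = trans (h≗Φ ⊤) (closed⇒trueSet {ℋ = ℋ} λ _ _ _ → ∈⊤)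
  ; contains = λ _ → ∈⊤
  ; smallest = λ Z holds X⊆Z {y} _ → spans (trueSet⇒closed (trans (sym (h≗Φ Z)) holds)) X⊆Z y
  }

-- Key sets in terms of spanning sets

module _ {n : ℕ} (𝒦 : Hypergraph n) where

  Independent : Subset n → Set
  Independent X = ∀ K → K List.∈ 𝒦 → ¬ (K ⊆ X)

  -- A decidable search through `𝒦` turns the negation into a witness.
  dependent : ∀ {X} → ¬ Independent X → Σ[ K ∈ Subset n ] K List.∈ 𝒦 × K ⊆ X
  dependent {X} ¬ind with any? (_⊆? X) 𝒦
  ... | yes some = List.find some
  ... | no none  = contradiction (λ K K∈ K⊆ → none (List.lose K∈ λ {x} → K⊆ {x})) ¬ind

  -- The spanning sets are exactly the sets that contain a member of `𝒦`. For Sperner `𝒦` this is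
  -- equivalent to `𝒦` being the key set, and it avoids talk of minimality.
  record Realizes (ℋ : Hypergraph n) : Set where
    field
      keys-span       : ∀ {K} → K List.∈ 𝒦 → Spans ℋ K
      spans-dependent : ∀ {X} → Spans ℋ X → ¬ Independent X
  open Realizes

  -- By induction on size, no proper subset of an independent spanning set spans. Such a set would
  -- thus be a minimal key, hence itself in `𝒦`.
  isKeySet⇒realizes : ∀ {h ℋ} → h ≗ Φ ℋ → IsKeySetOf 𝒦 h → Realizes ℋ
  isKeySet⇒realizes {h} {ℋ} h≗Φ keys = record
    { keys-span       = λ {K} K∈ → generates⇒spans h≗Φ (proj₁ (Equivalence.to (keys K) K∈))
    ; spans-dependent = λ {X} → dep (suc ∣ X ∣) ≤-refl
    }
    where
    dep : ∀ k {X} → ∣ X ∣ < k → Spans ℋ X → ¬ Independent X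
    dep (suc k) {X} (s≤s X≤k) spans ind =
      ind X (Equivalence.from (keys X) (spans⇒generates h≗Φ spans , minimal)) (λ x∈ → x∈)
      where
      minimal : ∀ X′ → Generates h X′ → X′ ⊆ X → X′ ≡ X
      minimal X′ gen X′⊆X with X′ ⊂? X
      ... | yes X′⊂X = contradiction (λ K K∈ K⊆ → ind K K∈ λ x∈ → X′⊆X (K⊆ x∈))
        (dep k (<-≤-trans (p⊂q⇒∣p∣<∣q∣ X′⊂X) X≤k) (generates⇒spans h≗Φ gen))
      ... | no X′⊄X  = ⊆-antisym X′⊆X λ {x} x∈ →
        decidable-stable (x ∈? X′) λ x∉ → X′⊄X (X′⊆X , x , x∈ , x∉)

  -- Every spanning set contains some `K″ ∈ 𝒦`, which spans too. Below a member of `𝒦`, the Sperner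
  -- property makes `K″` equal to it; below a minimal key, minimality does.
  realizes⇒isKeySet : ∀ {ℋ} → Sperner 𝒦 → Realizes ℋ → IsKeySetOf 𝒦 (Φ ℋ)
  realizes⇒isKeySet {ℋ} sperner r K = mk⇔ minimal member
    where
    comparable : ∀ {K K′} → K List.∈ 𝒦 → K′ List.∈ 𝒦 → K ⊆ K′ → K ≡ K′
    comparable K∈ K′∈ K⊆ = decidable-stable (_ ≟ˢ _) λ K≢ → sperner _ _ K∈ K′∈ K≢ K⊆
    minimal : K List.∈ 𝒦 → MinimalKey (Φ ℋ) K
    minimal K∈ = spans⇒generates (λ _ → refl) (keys-span r K∈) , λ K′ gen K′⊆K →
      let K″ , K″∈ , K″⊆K′ = dependent (spans-dependent r (generates⇒spans (λ _ → refl) gen))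
          K″≡K = comparable K″∈ K∈ (λ x∈ → K′⊆K (K″⊆K′ x∈))
      in ⊆-antisym K′⊆K (subst (_⊆ K′) K″≡K K″⊆K′)
    member : MinimalKey (Φ ℋ) K → K List.∈ 𝒦
    member (gen , min) =
      let K″ , K″∈ , K″⊆K = dependent (spans-dependent r (generates⇒spans (λ _ → refl) gen))
      in subst (List._∈ 𝒦) (min K″ (spans⇒generates (λ _ → refl) (keys-span r K″∈)) K″⊆K) K″∈

  realizable : ∀ {ℋ} → IsKeySetOf 𝒦 (Φ ℋ) → Realizable 𝒦
  realizable {ℋ} keys = Φ ℋ , ((concatMap edgeClauses ℋ , λ _ → refl) , (ℋ , λ _ → refl)) , keys

  -- Stable sets

  Covered : Subset n → Subset n → Fin n → Set
  Covered S K u = Σ[ K′ ∈ Subset n ] K′ List.∈ 𝒦 × u ∉ K′ × (∀ {w} → w ∈ K′ → w ∈ S ⊎ w ∈ K)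

  Stable : Subset n → Set
  Stable H = ∀ {K u} → K List.∈ 𝒦 → u ∈ K → u ∈ H → Covered H K u

  realizes⇒stable : ∀ {ℋ H} → Realizes ℋ → H List.∈ ℋ → Stable H
  realizes⇒stable {ℋ} {H} r H∈ {K} {u} K∈ u∈K u∈H =
    let K′ , K′∈ , K′⊆X = dependent (spans-dependent r spans)
    in K′ , K′∈ , (λ u∈ → ∉-remove (K′⊆X u∈)) , λ w∈ → x∈p∪q⁻ H K (remove-⊆ (K′⊆X w∈))
    where
    X : Subset n
    X = (H ∪ K) [ u ]≔ false
    spans : Spans ℋ X
    spans {Z} closed X⊆Z = keys-span r K∈ closed K⊆Z
      where
      u∈Z : u ∈ Z
      u∈Z = closed H∈ u∈H λ w∈ w≢u → X⊆Z (∈-update⁺ w≢u (x∈p∪q⁺ (inj₁ w∈)))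
      K⊆Z : K ⊆ Z
      K⊆Z {w} w∈ with w Fin.≟ u
      ... | yes refl = u∈Z
      ... | no w≢u   = X⊆Z (∈-update⁺ w≢u (x∈p∪q⁺ (inj₂ w∈)))

  stable⇒realizes : ∀ {ℋ K₀} → K₀ List.∈ 𝒦 → (∀ {H} → H List.∈ ℋ → Stable H) →
                    (∀ {K} → K List.∈ 𝒦 → Spans ℋ K) → Realizes ℋ
  stable⇒realizes {ℋ} {K₀} K₀∈ stable keys = record
    { keys-span = keys ; spans-dependent = λ {X} → dep n (m≤n+m n ∣ X ∣) }
    where
    -- `k` bounds the number of vertices outside `X`.
    dep : ∀ k {X} → n ≤ ∣ X ∣ + k → Spans ℋ X → ¬ Independent X
    -- A closed spanning set is V and so contains `K₀`; this is where `𝒦` has to be nonempty.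
    dep k {X} n≤ spans ind = ind K₀ K₀∈ λ {y} _ → spans closed (λ x∈ → x∈) y
      where
      inserted : ∀ k {v} → n ≤ ∣ X ∣ + k → v ∉ X → ¬ Independent (X [ v ]≔ true)
      -- For `k = 0` the set `X` is already all of V, so no vertex is left to insert.
      inserted zero    n≤ v∉ _ = <⇒≱ (insert-grows v∉)
          (≤-trans (∣p∣≤n (X [ _ ]≔ true)) (≤-trans n≤ (≤-reflexive (+-identityʳ ∣ X ∣))))
      inserted (suc k) n≤ v∉ = dep k (≤-trans n≤ (≤-trans (≤-reflexive (+-suc ∣ X ∣ k))
          (+-monoˡ-≤ k (insert-grows v∉)))) (λ closed X⊆ → spans closed (λ x∈ → X⊆ (⊆-insert x∈)))
      closed : Closed ℋ X
      closed {H} {v} H∈ v∈H rest with v ∈? X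
      ... | yes v∈ = v∈
      ... | no v∉  = contradiction ind′ (inserted k n≤ v∉)
        where
        H⊆ : ∀ {w} → w ∈ H → w ∈ X [ v ]≔ true
        H⊆ {w} w∈ with w Fin.≟ v
        ... | yes refl = []≔-updates X v
        ... | no w≢v   = ⊆-insert (rest w∈ w≢v)
        ind′ : Independent (X [ v ]≔ true)
        ind′ K K∈ K⊆ with v ∈? K
        ... | no v∉K = ind K K∈ λ {w} w∈ → ∈-update⁻ (λ { refl → v∉K w∈ }) (K⊆ w∈)
        ... | yes v∈K with stable H∈ K∈ v∈K v∈H
        ... | K′ , K′∈ , v∉K′ , K′⊆ = ind K′ K′∈ λ {w} w∈ →
          ∈-update⁻ (λ { refl → v∉K′ w∈ }) ([ H⊆ , K⊆ ]′ (K′⊆ w∈))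

-- Correctness of the search

module Correctness {n : ℕ} (𝒦 : Hypergraph n) where
  open Model 𝒦
  open Realizes

  missing≡0⁻ : ∀ S M K → missing S M K ≡ 0 → ∀ {w} → w ∈ K → w ∈ S ⊎ w ∈ M
  missing≡0⁻ S M K eq {w} w∈ = present (lookup S w) (lookup M w) refl refl
    (proj₂ (sum≡0⁻ (λ w → 1 ∸ (bit (lookup S w) + bit (lookup M w))) (members K) eq) (∈-members⁺ w∈))
    where
    present : ∀ b c → lookup S w ≡ b → lookup M w ≡ c → 1 ∸ (bit b + bit c) ≡ 0 → w ∈ S ⊎ w ∈ M
    present true  _    s≡ m≡ _ = inj₁ (lookup⇒[]= w S s≡)
    present false true s≡ m≡ _ = inj₂ (lookup⇒[]= w M m≡)

  missing≡0⁺ : ∀ S M K → (∀ {w} → w ∈ K → w ∈ S ⊎ w ∈ M) → missing S M K ≡ 0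
  missing≡0⁺ S M K cover = sum≡0⁺ _ (members K) refl λ w∈ → absent (cover (∈-members⁻ w∈))
    where
    absent : ∀ {w} → w ∈ S ⊎ w ∈ M → 1 ∸ (bit (lookup S w) + bit (lookup M w)) ≡ 0
    absent {w} (inj₁ w∈) rewrite []=⇒lookup w∈ = 0∸n≡0 (bit (lookup M w))
    absent {w} (inj₂ w∈) rewrite []=⇒lookup w∈ = m≤n⇒m∸n≡0 (m≤n+m 1 (bit (lookup S w)))

  found⁻ : ∀ S M → positive (found S M) ≡ true → Σ[ K ∈ Subset n ] K List.∈ 𝒦 × missing S M K ≡ 0
  found⁻ S M pos with any? (λ K → missing S M K ≟ 0) 𝒦
  ... | yes some = List.find some
  ... | no none with () ← trans (sym pos) (cong positive
          (sum≡0⁺ (λ K → 1 ∸ missing S M K) 𝒦 refl λ {K} K∈ → m≤n⇒m∸n≡0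
              (n≢0⇒n>0 λ z → none (List.lose K∈ z))))

  found⁺ : ∀ S M {K} → K List.∈ 𝒦 → missing S M K ≡ 0 → positive (found S M) ≡ true
  found⁺ S M {K} K∈ z with found S M in eq
  ... | suc _ = refl
  ... | zero with trans (sym (cong (1 ∸_) z)) (proj₂ (sum≡0⁻ (λ K → 1 ∸ missing S M K) 𝒦 eq) K∈)
  ...   | ()

  -- A set inside the union of `S` and `K`, both without `u`, avoids `u`; one inclusion test thus
  -- checks both conditions.
  covered⁻ : ∀ {S K u} → positive (found (S [ u ]≔ false) (K [ u ]≔ false)) ≡ true → Covered 𝒦 S K u
  covered⁻ {S} {K} {u} pos with found⁻ (S [ u ]≔ false) (K [ u ]≔ false) pos
  ... | K′ , K′∈ , z = K′ , K′∈ , (λ u∈ → [ ∉-remove {S = S} , ∉-remove {S = K} ]′ (cover u∈)) ,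
    λ w∈ → [ (λ w∈S → inj₁ (remove-⊆ w∈S)) , (λ w∈K → inj₂ (remove-⊆ w∈K)) ]′ (cover w∈)
    where
    cover : ∀ {w} → w ∈ K′ → w ∈ S [ u ]≔ false ⊎ w ∈ K [ u ]≔ false
    cover = missing≡0⁻ (S [ u ]≔ false) (K [ u ]≔ false) K′ z

  covered⁺ : ∀ {S K u} → Covered 𝒦 S K u → positive (found (S [ u ]≔ false) (K [ u ]≔ false)) ≡ true
  covered⁺ {S} {K} {u} (K′ , K′∈ , u∉ , cover) =
    found⁺ (S [ u ]≔ false) (K [ u ]≔ false) K′∈ (missing≡0⁺ (S [ u ]≔ false) (K [ u ]≔ false) K′
        λ {w} w∈ →
      let w≢u : w ≢ u
          w≢u = λ { refl → u∉ w∈ }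
      in [ (λ w∈S → inj₁ (∈-update⁺ w≢u w∈S)) , (λ w∈K → inj₂ (∈-update⁺ w≢u w∈K)) ]′ (cover w∈))

  trial-⊆ : ∀ {K S u} → trial K S u ⊆ S
  trial-⊆ {K} {S} {u} {x} x∈ with x Fin.≟ u
  ... | no x≢u = ∈-update⁻ x≢u x∈
  ... | yes refl with u ∈? S
  ...   | yes u∈ = u∈
  ...   | no u∉ rewrite ∉⇒lookup u∉ = contradiction x∈ ∉-remove

  trial-keeps : ∀ {K S u} → Covered 𝒦 S K u → trial K S u ≡ S
  trial-keeps {K} {S} {u} c rewrite covered⁺ c =
    trans (cong (S [ u ]≔_) (Bool.∧-identityʳ (lookup S u))) ([]≔-lookup S u)

  trial-fixed : ∀ {K S u} → u ∈ S → trial K S u ≡ S → Covered 𝒦 S K u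
  trial-fixed {K} {S} {u} u∈ fixed = covered⁻ (begin
    positive k                                 ≡⟨ cong (_∧ positive k) (sym ([]=⇒lookup u∈)) ⟩
    lookup S u ∧ positive k                    ≡⟨ sym (lookup∘update u S (lookup S u ∧ positive k)) ⟩
    lookup (trial K S u) u                     ≡⟨ cong (λ S → lookup S u) fixed ⟩
    lookup S u                                 ≡⟨ []=⇒lookup u∈ ⟩
    true                                       ∎)
    where
    open ≡-Reasoning
    k : ℕ
    k = found (S [ u ]≔ false) (K [ u ]≔ false)

  -- Deletions raise it, so the results on increasing ranks apply to shrinking sets.
  corank : Subset n → ℕ
  corank S = n ∸ ∣ S ∣

  trial-progress : ∀ K → Progressive (trial K) corank
  trial-progress K S u = go (lookup S u) (positive (found (S [ u ]≔ false) (K [ u ]≔ false))) refl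
    where
    go : ∀ b c → lookup S u ≡ b →
         S [ u ]≔ (lookup S u ∧ c) ≡ S ⊎ corank S < corank (S [ u ]≔ (lookup S u ∧ c))
    go false c     s≡ rewrite s≡ = inj₁ (trans (cong (S [ u ]≔_) (sym s≡)) ([]≔-lookup S u))
    go true  true  s≡ rewrite s≡ = inj₁ (trans (cong (S [ u ]≔_) (sym s≡)) ([]≔-lookup S u))
    go true  false s≡ rewrite s≡ = inj₂ (∸-monoʳ-< (remove-shrinks (lookup⇒[]= u S s≡)) (∣p∣≤n S))

  sweepEdge-progress : Progressive sweepEdge corank
  sweepEdge-progress S K = foldl-progress (trial K) corank (trial-progress K) (members K) S

  -- The last sweep has reached a fixed point, where every single trial is stationary, and a
  -- stationary trial of a vertex in the set has found a covering key.
  shrink-stable : ∀ S → Stable 𝒦 (shrink S)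
  shrink-stable S {K} {u} K∈ u∈K u∈ = trial-fixed {K} {shrink S} {u} u∈
    (foldl-fixed (trial K) corank (trial-progress K) (members K)
      (foldl-fixed sweepEdge corank sweepEdge-progress 𝒦
        (iterate-fixed sweep corank (foldl-progress sweepEdge corank sweepEdge-progress 𝒦)
          (λ S → m∸n≤m n ∣ S ∣) (allFin n) (≤-reflexive (sym (length-tabulate {n = n} id))) S)
        K∈)
      (∈-members⁺ u∈K))

  shrink-preserves : ∀ (P : Subset n → Set) → (∀ {S K u} → K List.∈ 𝒦 → u ∈ K → P S → P (trial K S u)) →
                     ∀ {S} → P S → P (shrink S)
  shrink-preserves P step = foldl-preserves (λ S _ → sweep S) P (allFin n) λ _ →
    foldl-preserves sweepEdge P 𝒦 λ {_} {K} K∈ → foldl-preserves (trial K) P (members K) λ u∈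
        → step K∈ (∈-members⁻ u∈)

  shrink-⊆ : ∀ S → shrink S ⊆ S
  shrink-⊆ S = shrink-preserves (_⊆ S) (λ {S′} {K} {u} _ _ S′⊆ {x} x∈ → S′⊆
      (trial-⊆ {K} {S′} {u} x∈)) λ x∈ → x∈

  -- A key covering `u` for `H` also covers it for every `S` that contains `H`, so no trial ever
  -- deletes a vertex of `H`.
  shrink-largest : ∀ {H S} → Stable 𝒦 H → H ⊆ S → H ⊆ shrink S
  shrink-largest {H} stable = shrink-preserves (H ⊆_) step
    where
    step : ∀ {S K u} → K List.∈ 𝒦 → u ∈ K → H ⊆ S → H ⊆ trial K S u
    step {S} {K} {u} K∈ u∈K H⊆S {x} x∈ with x Fin.≟ u
    ... | no x≢u   = ∈-update⁺ x≢u (H⊆S x∈)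
    ... | yes refl with stable K∈ u∈K x∈
    ...   | K′ , K′∈ , u∉ , cover =
      subst (x ∈_) (sym (trial-keeps (K′ , K′∈ , u∉ , λ w∈ → [ (λ w∈H → inj₁ (H⊆S w∈H)) , inj₂ ]′
          (cover w∈)))) (H⊆S x∈)

  -- A view of the Boolean test in `extend`; `keep` merges its two ways to fail.
  data Extension (T : Subset n) (ℋ : Hypergraph n) (v : Fin n) : Subset n × Hypergraph n → Set where
    add  : v ∉ T → v ∈ shrink (T [ v ]≔ true) →
           Extension T ℋ v (T [ v ]≔ true , ℋ ∷ʳ shrink (T [ v ]≔ true))
    keep : (v ∉ T → v ∉ shrink (T [ v ]≔ true)) → Extension T ℋ v (T , ℋ)

  extension : ∀ T ℋ v → Extension T ℋ v (extend (T , ℋ) v)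
  extension T ℋ v with lookup (shrink (T [ v ]≔ true)) v in s≡ | lookup T v in t≡
  ... | true  | true  = keep λ v∉ _ → v∉ (lookup⇒[]= v T t≡)
  ... | true  | false = add (λ v∈ → case trans (sym t≡) ([]=⇒lookup v∈) of λ ()) (lookup⇒[]= v _ s≡)
  ... | false | _     = keep λ _ v∈ → case trans (sym s≡) ([]=⇒lookup v∈) of λ ()

  -- `ℋ` changes only together with `T`, so the size of `T` detects every change.
  extend-progress : Progressive extend (∣_∣ ∘ proj₁)
  extend-progress (T , ℋ) v with extend (T , ℋ) v | extension T ℋ v
  ... | _ | add v∉ _ = inj₂ (insert-grows v∉)
  ... | _ | keep _   = inj₁ refl

  -- `forced` places `T` inside the closure of `K`, and `economic` charges every new hyperedge to a
  -- new vertex of `T`.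
  record Reached (K : Subset n) (ℋ₀ : Hypergraph n) (s : Subset n × Hypergraph n) : Set where
    field
      grows    : ∀ {H} → H List.∈ ℋ₀ → H List.∈ proj₂ s
      stable   : ∀ {H} → H List.∈ proj₂ s → Stable 𝒦 H
      base     : K ⊆ proj₁ s
      forced   : ∀ {Z} → Closed (proj₂ s) Z → K ⊆ Z → proj₁ s ⊆ Z
      economic : length (proj₂ s) + ∣ K ∣ ≤ length ℋ₀ + ∣ proj₁ s ∣

  extend-reached : ∀ {K ℋ₀ s v} → Reached K ℋ₀ s → Reached K ℋ₀ (extend s v)
  extend-reached {K} {ℋ₀} {T , ℋ} {v} r with extend (T , ℋ) v | extension T ℋ v
  ... | _ | keep _ = r
  ... | _ | add v∉ v∈ = record
    { grows    = λ H∈ → List.∈-++⁺ˡ (grows H∈)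
    ; stable   = λ H∈ → [ stable , (λ { (here refl) → shrink-stable T′ }) ]′ (List.∈-++⁻ ℋ H∈)
    ; base     = λ x∈ → ⊆-insert (base x∈)
    ; forced   = forced′
    ; economic = begin
        length (ℋ ∷ʳ shrink T′) + ∣ K ∣ ≡⟨ cong (_+ ∣ K ∣) (trans (length-++ ℋ) (+-comm (length ℋ) 1)) ⟩
        suc (length ℋ + ∣ K ∣)          ≤⟨ s≤s economic ⟩
        suc (length ℋ₀ + ∣ T ∣)         ≡⟨ sym (+-suc (length ℋ₀) ∣ T ∣) ⟩
        length ℋ₀ + suc ∣ T ∣           ≤⟨ +-monoʳ-≤ (length ℋ₀) (insert-grows v∉) ⟩
        length ℋ₀ + ∣ T′ ∣              ∎
    }
    where
    open Reached r
    open ≤-Reasoning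
    T′ : Subset n
    T′ = T [ v ]≔ true
    forced′ : ∀ {Z} → Closed (ℋ ∷ʳ shrink T′) Z → K ⊆ Z → T′ ⊆ Z
    forced′ {Z} closed K⊆Z {x} x∈ with x Fin.≟ v
    ... | no x≢v   = forced (λ H∈ → closed (List.∈-++⁺ˡ H∈)) K⊆Z (∈-update⁻ x≢v x∈)
    -- The new hyperedge lies in `T` together with `v`. Its other vertices are forced already, so
    -- its clause with head `v` forces `v`.
    ... | yes refl = closed (List.∈-++⁺ʳ ℋ (here refl)) v∈ λ w∈ w≢v →
      forced (λ H∈ → closed (List.∈-++⁺ˡ H∈)) K⊆Z (∈-update⁻ w≢v (shrink-⊆ T′ w∈))

  saturate-reached : ∀ K ℋ₀ → (∀ {H} → H List.∈ ℋ₀ → Stable 𝒦 H) → Reached K ℋ₀ (saturate (K , ℋ₀))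
  saturate-reached K ℋ₀ stable =
    foldl-preserves (λ s _ → round s) (Reached K ℋ₀) (allFin n)
      (λ _ → foldl-preserves extend (Reached K ℋ₀) (allFin n) λ _ → extend-reached)
      (record { grows = λ H∈ → H∈ ; stable = stable ; base = λ x∈ → x∈ ; forced = λ _ K⊆Z
          → K⊆Z ; economic = ≤-refl })

  -- After `n` rounds a further round changes nothing, hence neither does any of its extensions.
  saturate-fixed : ∀ s v → extend (saturate s) v ≡ saturate s
  saturate-fixed s v = foldl-fixed extend (∣_∣ ∘ proj₁) extend-progress (allFin n)
    (iterate-fixed round (∣_∣ ∘ proj₁) (foldl-progress extend (∣_∣ ∘ proj₁) extend-progress (allFin n))
      (λ (T , _) → ∣p∣≤n T) (allFin n) (≤-reflexive (sym (length-tabulate {n = n} id))) s)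
    (List.∈-allFin v)

  -- A realizer only has stable hyperedges, and shrink finds the largest stable
  -- set, so that the saturated set is closed for any realizer.
  saturate-complete : ∀ {ℛ K ℋ₀} → Realizes 𝒦 ℛ → K List.∈ 𝒦 → (∀ {H} → H List.∈ ℋ₀ → Stable 𝒦 H) →
                      ∀ y → y ∈ proj₁ (saturate (K , ℋ₀))
  saturate-complete {ℛ} {K} {ℋ₀} r K∈ stable = keys-span r K∈ closed
      (Reached.base (saturate-reached K ℋ₀ stable))
    where
    T : Subset n
    T = proj₁ (saturate (K , ℋ₀))
    ℋ : Hypergraph n
    ℋ = proj₂ (saturate (K , ℋ₀))
    closed : Closed ℛ T
    closed {H} {v} H∈ v∈ rest with v ∈? T
    ... | yes v∈T = v∈T
    ... | no v∉T with extend (T , ℋ) v | extension T ℋ v | saturate-fixed (K , ℋ₀) v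
    ...   | _ | add _ _   | fixed = subst (v ∈_) (cong proj₁ fixed) ([]≔-updates T v)
    ...   | _ | keep none | _ = contradiction (shrink-largest (realizes⇒stable 𝒦 r H∈) H⊆ v∈) (none v∉T)
      where
      H⊆ : H ⊆ T [ v ]≔ true
      H⊆ {w} w∈ with w Fin.≟ v
      ... | yes refl = []≔-updates T v
      ... | no w≢v   = ⊆-insert (rest w∈ w≢v)

  -- The search over all keys

  AllStable : Hypergraph n → Set
  AllStable ℋ = ∀ {H} → H List.∈ ℋ → Stable 𝒦 H

  deficit≡0⁻ : ∀ {d T} → deficit d T ≡ 0 → d ≡ 0 × (∀ y → y ∈ T)
  deficit≡0⁻ {d} {T} eq with sum≡0⁻ (λ v → 1 ∸ bit (lookup T v)) (allFin n) eq
  ... | d≡0 , zeros = d≡0 , λ y → present y (lookup T y) refl (zeros (List.∈-allFin y))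
    where
    present : ∀ y b → lookup T y ≡ b → 1 ∸ bit b ≡ 0 → y ∈ T
    present y true t≡ _ = lookup⇒[]= y T t≡

  deficit≡0⁺ : ∀ {d T} → d ≡ 0 → (∀ y → y ∈ T) → deficit d T ≡ 0
  deficit≡0⁺ {d} {T} d≡0 all∈ = sum≡0⁺ _ (allFin n) d≡0 λ {y} _ → cong (λ b → 1 ∸ bit b)
      ([]=⇒lookup (all∈ y))

  -- With a realizer every saturation reaches V, so no key adds to the deficit. Stability is carried
  -- along because each saturation starts from the hyperedges of the earlier ones.
  search-complete : ∀ {ℛ} → Realizes 𝒦 ℛ → proj₂ search ≡ 0
  search-complete r = proj₂ (foldl-preserves perEdge (λ (ℋ , d) → AllStable ℋ × d ≡ 0) 𝒦
    (λ { {ℋ , _} {K} K∈ (stable , d≡0) →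
           (λ {H} → Reached.stable (saturate-reached K ℋ stable)) , deficit≡0⁺ d≡0
               (saturate-complete r K∈ stable) })
    {[] , 0} ((λ ()) , refl))

  record Spanning (ℋ₀ : Hypergraph n) (Ks : List (Subset n)) (ℋ : Hypergraph n) : Set where
    field
      stable   : AllStable ℋ
      grows    : ∀ {H} → H List.∈ ℋ₀ → H List.∈ ℋ
      spanning : ∀ {K} → K List.∈ Ks → Spans ℋ K
      size     : length ℋ ≤ length ℋ₀ + n * length Ks

  -- A final deficit 0 was 0 throughout, so each `K` forces all of V by the hyperedges present after
  -- its saturation. These are never removed, so `K` still spans for the final family.
  search-spanning : ∀ Ks {ℋ₀ d} → AllStable ℋ₀ → proj₂ (foldl perEdge (ℋ₀ , d) Ks) ≡ 0 →
                    d ≡ 0 × Spanning ℋ₀ Ks (proj₁ (foldl perEdge (ℋ₀ , d) Ks))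
  search-spanning [] {ℋ₀} stable d≡0 = d≡0 , record
    { stable = stable ; grows = λ H∈ → H∈ ; spanning = λ () ; size = m≤m+n (length ℋ₀) (n * 0) }
  search-spanning (K ∷ Ks) {ℋ₀} {d} stable eq = proj₁ zero-K , record
    { stable   = Spanning.stable rest
    ; grows    = λ H∈ → Spanning.grows rest (Reached.grows here′ H∈)
    ; spanning = λ where
        (here refl) → λ closed K⊆Z y →
          Reached.forced here′ (λ H∈ → closed (Spanning.grows rest H∈)) K⊆Z (proj₂ zero-K y)
        (there K∈)  → Spanning.spanning rest K∈
    ; size     = begin
        length ℋ                            ≤⟨ Spanning.size rest ⟩
        length ℋ₁ + n * length Ks           ≤⟨ +-monoˡ-≤ (n * length Ks)
            (m+n≤o⇒m≤o (length ℋ₁) (Reached.economic here′)) ⟩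
        length ℋ₀ + ∣ T ∣ + n * length Ks   ≤⟨ +-monoˡ-≤ (n * length Ks)
            (+-monoʳ-≤ (length ℋ₀) (∣p∣≤n T)) ⟩
        length ℋ₀ + n + n * length Ks       ≡⟨ +-assoc (length ℋ₀) n _ ⟩
        length ℋ₀ + (n + n * length Ks)     ≡⟨ cong (length ℋ₀ +_) (sym (*-suc n (length Ks))) ⟩
        length ℋ₀ + n * suc (length Ks)     ∎
    }
    where
    open ≤-Reasoning
    here′ = saturate-reached K ℋ₀ stable
    T  = proj₁ (saturate (K , ℋ₀))
    ℋ₁ = proj₂ (saturate (K , ℋ₀))
    later = search-spanning Ks {ℋ₁} {deficit d T} (Reached.stable here′) eq
    zero-K = deficit≡0⁻ (proj₁ later)
    rest = proj₂ later
    ℋ = proj₁ (foldl perEdge (ℋ₁ , deficit d T) Ks)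

-- Running time and output

-- Only 𝒦 = {∅} has more hyperedges than its total size.
length≤‖‖ : ∀ {n} (𝒦 : Hypergraph n) → Unique 𝒦 → Sperner 𝒦 → length 𝒦 ≤ 1 ⊔ ‖ 𝒦 ‖
length≤‖‖ {n} 𝒦 unique sperner with any? (λ K → ∣ K ∣ ≟ 0) 𝒦
... | no none = ≤-trans (nonempty 𝒦 λ K∈ empty → none (List.lose K∈ empty)) (m≤n⊔m 1 ‖ 𝒦 ‖)
  where
  nonempty : ∀ 𝒢 → (∀ {K} → K List.∈ 𝒢 → ∣ K ∣ ≢ 0) → length 𝒢 ≤ ‖ 𝒢 ‖
  nonempty []      _  = z≤n
  nonempty (K ∷ 𝒢) ≢0 = +-mono-≤ (n≢0⇒n>0 (≢0 (here refl))) (nonempty 𝒢 (≢0 ∘ there))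
... | yes some with List.find some
-- The empty set lies in every member of `𝒦`, so the Sperner property leaves no other member.
...   | K , K∈ , empty = ≤-trans (singleton 𝒦 unique (λ {K′} K′∈ →
        decidable-stable (K ≟ˢ K′) λ K≢ → sperner K K′ K∈ K′∈ K≢ λ x∈ → contradiction
            (x∈p⇒∣p-x∣<∣p∣ x∈) λ lt → n≮0 (subst (∣ K - _ ∣ <_) empty lt)))
      (m≤m⊔n 1 ‖ 𝒦 ‖)
  where
  singleton : ∀ 𝒢 → Unique 𝒢 → (∀ {K′} → K′ List.∈ 𝒢 → K ≡ K′) → length 𝒢 ≤ 1
  singleton []          _ _  = z≤n
  singleton (_ ∷ [])    _ _  = s≤s z≤n
  singleton (_ ∷ _ ∷ _) ((K≢ ∷ _) ∷ _) same =
    contradiction (trans (sym (same (here refl))) (same (there (here refl)))) K≢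

suc≤2*1⊔ : ∀ k → suc k ≤ 2 * (1 ⊔ k)
suc≤2*1⊔ k = +-mono-≤ (m≤m⊔n 1 k) (≤-trans (m≤n⊔m 1 k) (≤-reflexive (sym (+-identityʳ _))))

-- The cube comes from rounds, vertices tried in a round and sweeps; the square from trials and the
-- scan in each. The constant is 144 = 2⁴ · 3², with 2 for each successor and 3 for each `L`.
work≤ : ∀ {n} (𝒦 : Hypergraph n) → Unique 𝒦 → Sperner 𝒦 →
        Refinement.W₅ 𝒦 ≤ 144 * ((1 ⊔ n) ^ 3 * (1 ⊔ length 𝒦) * (1 ⊔ ‖ 𝒦 ‖) ^ 2)
work≤ {n} 𝒦 unique sperner = begin
  suc (length 𝒦) * (suc n * (suc n * (suc n * (L * L))))
    ≤⟨ *-mono-≤ (suc≤2*1⊔ (length 𝒦)) (*-mono-≤ N≤ (*-mono-≤ N≤ (*-mono-≤ N≤ (*-mono-≤ L≤ L≤)))) ⟩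
  2 * b * (2 * a * (2 * a * (2 * a * (3 * c * (3 * c)))))
    ≡⟨ solve 3 (λ a b c → con 2 :* b :* (con 2 :* a :*
        (con 2 :* a :* (con 2 :* a :* (con 3 :* c :* (con 3 :* c)))))
                          :≡ con 144 :* (a :^ 3 :* b :* c :^ 2)) refl a b c ⟩
  144 * (a ^ 3 * b * c ^ 2) ∎
  where
  open ≤-Reasoning
  open +-*-Solver using (solve; con; _:*_; _:^_) renaming (_:=_ to _:≡_)
  open Loops 𝒦 using (L)
  a = 1 ⊔ n
  b = 1 ⊔ length 𝒦
  c = 1 ⊔ ‖ 𝒦 ‖
  N≤ : suc n ≤ 2 * a
  N≤ = suc≤2*1⊔ n
  L≤ : L ≤ 3 * c
  -- All three summands of `L` are at most `c`, the number of hyperedges because `𝒦` is Sperner and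
  -- free of repetitions.
  L≤ = +-mono-≤ (m≤m⊔n 1 ‖ 𝒦 ‖) (+-mono-≤ (length≤‖‖ 𝒦 unique sperner)
      (≤-trans (m≤n⊔m 1 ‖ 𝒦 ‖) (≤-reflexive (sym (+-identityʳ c)))))

holds-lookup : ∀ {a} ws {p} → Holds a p ws → ∀ i → a (p + toℕ i) ≡ lookupᴸ ws i
holds-lookup {a} (w ∷ ws) {p} (eq , _) zero    = trans (cong a (+-identityʳ p)) eq
holds-lookup {a} (w ∷ ws) {p} (_ , h)  (suc i) = trans (cong a (+-suc p (toℕ i))) (holds-lookup ws h i)

Answers : ∀ {n} → Hypergraph n → State → Set
Answers {n} 𝒦 σ =
  (¬ Realizable 𝒦 × Outputs σ (0 ∷ []))
  ⊎ (Realizable 𝒦 ×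
     (Σ[ ℋ ∈ Hypergraph n ]
        Outputs σ (1 ∷ encode ℋ) ×
        IsKeySetOf 𝒦 (Φ ℋ) ×
        length ℋ ≤ n * length 𝒦))

module _ {n : ℕ} where
  open Model
  open Refinement using (answer)
  open Correctness
  open Realizes

  answers : ∀ (𝒦 : Hypergraph n) {σ} → Sperner 𝒦 →
            Holds (arrays σ 1) 0 (answer 𝒦 ∷ encode (proj₁ (search 𝒦))) → Answers 𝒦 σ
  -- V always spans, yet contains no member of the empty family.
  answers [] {σ} sperner (eq , _) = inj₁
    ( (λ (h , (_ , (ℋ , h≗Φ)) , keys) →
        spans-dependent (isKeySet⇒realizes [] {ℋ = ℋ} h≗Φ keys) {⊤} (λ _ ⊤⊆Z y → ⊤⊆Z ∈⊤) λ _ ())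
    , λ { zero → eq })
  answers 𝒦@(_ ∷ 𝒦₁) {σ} sperner out = decide (proj₂ (search 𝒦)) refl
    where
    ℋ : Hypergraph n
    ℋ = proj₁ (search 𝒦)
    answer≡ : ∀ {d} → proj₂ (search 𝒦) ≡ d → answer 𝒦 ≡ 1 ∸ d
    answer≡ = cong₂ (λ k d → 1 ∸ k ∸ d) (0∸n≡0 (length 𝒦₁))
    decide : ∀ d → proj₂ (search 𝒦) ≡ d → Answers 𝒦 σ
    decide (suc d) d≡ = inj₁
      ( (λ (h , (_ , (ℛ , h≗Φ)) , keys) →
          contradiction (trans (sym d≡) (search-complete 𝒦 (isKeySet⇒realizes 𝒦 {ℋ = ℛ} h≗Φ keys)))
              λ ())
      , λ { zero → trans (proj₁ out) (trans (answer≡ d≡) (0∸n≡0 d)) })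
    decide zero d≡ = inj₂ (realizable 𝒦 {ℋ} keys , ℋ , outputs , keys , Spanning.size result)
      where
      outputs : Outputs σ (1 ∷ encode ℋ)
      outputs = holds-lookup (1 ∷ encode ℋ) (trans (proj₁ out) (answer≡ d≡) , proj₂ out)
      result : Spanning 𝒦 [] 𝒦 ℋ
      result = proj₂ (search-spanning 𝒦 𝒦 (λ ()) d≡)
      keys : IsKeySetOf 𝒦 (Φ ℋ)
      keys = realizes⇒isKeySet 𝒦 sperner
        (stable⇒realizes 𝒦 (here refl) (Spanning.stable result) (Spanning.spanning result))

theorem29 :
    Σ[ p ∈ Program ] Σ[ c ∈ ℕ ]
      ∀ (n : ℕ) (𝒦 : Hypergraph n) → Unique 𝒦 → Sperner 𝒦 →
      Σ[ σ ∈ State ] Σ[ t ∈ ℕ ]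
        ⟨ p , initial 𝒦 ⟩⇓⟨ σ , t ⟩ ×
        t ≤ c * ((1 ⊔ n) ^ 3 * (1 ⊔ length 𝒦) * (1 ⊔ ‖ 𝒦 ‖) ^ 2) ×
        ( (¬ Realizable 𝒦 × Outputs σ (0 ∷ []))
        ⊎ (Realizable 𝒦 ×
           (Σ[ ℋ ∈ Hypergraph n ]
              Outputs σ (1 ∷ encode ℋ) ×
              IsKeySetOf 𝒦 (Φ ℋ) ×
              length ℋ ≤ n * length 𝒦)) )
-- The first factor is the number of steps per unit of work, the second bounds the work; neither
-- depends on the input.
theorem29 = algorithm , weight algorithm * 144 , λ n 𝒦 unique sperner →
  conclude 𝒦 unique sperner (Refinement.algorithm-spec 𝒦)
  where
  conclude : ∀ {n} (𝒦 : Hypergraph n) → Unique 𝒦 → Sperner 𝒦 →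
             Runs algorithm (initial 𝒦) (Refinement.W₅ 𝒦)
               (λ σ → Holds (arrays σ 1) 0 (Refinement.answer 𝒦 ∷ encode (proj₁ (Model.search 𝒦)))) →
             Σ[ σ ∈ State ] Σ[ t ∈ ℕ ] ⟨ algorithm , initial 𝒦 ⟩⇓⟨ σ , t ⟩ ×
               t ≤ weight algorithm * 144 * ((1 ⊔ n) ^ 3 * (1 ⊔ length 𝒦) * (1 ⊔ ‖ 𝒦 ‖) ^ 2) ×
               Answers 𝒦 σ
  conclude {n} 𝒦 unique sperner (runs {σ} {t} exec bound out) =
    σ , t , exec , bound′ , answers 𝒦 {σ} sperner out
    where
    open ≤-Reasoning
    B = (1 ⊔ n) ^ 3 * (1 ⊔ length 𝒦) * (1 ⊔ ‖ 𝒦 ‖) ^ 2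
    bound′ : t ≤ weight algorithm * 144 * B
    bound′ = begin
      t                                ≤⟨ bound ⟩
      weight algorithm * Refinement.W₅ 𝒦 ≤⟨ *-monoʳ-≤ (weight algorithm) (work≤ 𝒦 unique sperner) ⟩
      weight algorithm * (144 * B)     ≡⟨ sym (*-assoc (weight algorithm) 144 B) ⟩
      weight algorithm * 144 * B       ∎
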